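{- Let $n\ge 2$, let $M,N\in\mathbb{Z}^{n-1}$ and let $D=(D_1,\dots,D_{n-1})$ be a tuple of positive integers. For a tuple $T=(T_1,\dots,T_{n-1})$ write $\tilde T=(T_{n-1},T_{n-2},\dots,T_1)$. Then the long Weyl element Kloosterman sums satisfy $S_n(M,N;D)=S_n(\tilde M,\tilde N;\tilde D)$.
   Context: Definition of $S_n(M,N;D)$: $e(z)=e^{2\pi i z}$. $U$ is the group of upper triangular unipotent $n\times n$ matrices. For $N\in\mathbb{Z}^{n-1}$, $\psi_N$ is the character of $U(\mathbb{R})$, trivial on $U(\mathbb{Z})$, given by $\psi_N(u)=e(N_1u_{1,2}+N_2u_{2,3}+\cdots+N_{n-1}u_{n-1,n})$. For $M\in \mathbb{Z}^{n-1}$, $\tilde M=(M_{n-1},\dots,M_1)$. Let $w_0$ be the long Weyl element: the $n\times n$ matrix whose only nonzero entries are on the anti-diagonal, the entry at position $(n-k+1,k)$ being $(-1)^{k-1}$ ($1\le k\le n$). Let $c=\mathrm{Diag}(1/D_{n-1},\,D_{n-1}/D_{n-2},\dots,D_2/D_1,\,D_1)$, $C(c)=U(\mathbb{R})\,c\,w_0\,U(\mathbb{R})\cap SL(n,\mathbb{Z})$ and $X(c)=U(\mathbb{Z})\backslash C(c)/U(\mathbb{Z})$. Each $\gamma\in C(c)$ is uniquely $\gamma=b_1cw_0b_2$ with $b_1,b_2\in U(\mathbb{R})$; set $\mu(\gamma)=b_1\in U(\mathbb{Z})\backslash U(\mathbb{R})$ and $\mu'(\gamma)=b_2\in U(\mathbb{R})/U(\mathbb{Z})$.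 Then $$S_n(M,N;D)=\sum_{x\in X(c)}\psi_{\tilde M}(\mu(x))\,\psi_N(\mu'(x)).$$ -}

module Defs where

open import Algebra.Bundles using (CommutativeRing)
open import Algebra.Morphism.Construct.Identity using (isRingHomomorphism)
open import Algebra.Morphism.Structures using (module RingMorphisms; module MonoidMorphisms)
open import Data.Empty using (⊥-elim)
open import Data.Fin.Base as Fin using (Fin; zero; suc; toℕ; fromℕ; inject₁; opposite; punchIn)
import Data.Fin.Properties as Fin
open import Data.Integer.Base as ℤ using (ℤ; +_; 1ℤ; 0ℤ)
import Data.Integer.DivMod as ℤ
import Data.Integer.Properties as ℤ
open import Data.List.Base as List using (List)
open import Data.List.Membership.Propositional using (_∈_)
open import Data.List.Membership.Propositional.Properties using (∈-upTo⁺)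
import Data.List.Membership.Setoid.Properties as Membership
open import Data.List.Relation.Unary.All as All using (All)
open import Data.List.Relation.Unary.AllPairs as AllPairs using (AllPairs)
open import Data.List.Relation.Unary.Any as Any using (Any; here)
import Data.List.Relation.Unary.Any.Properties as Any
open import Data.List.Relation.Unary.Unique.DecSetoid.Properties using (deduplicate-!)
open import Data.Nat.Base as ℕ using (ℕ; zero; suc; s≤s; z≤n; NonZero)
import Data.Nat.Coprimality as Coprime
import Data.Nat.Properties as ℕ
open import Data.Product.Base using (_×_; _,_; proj₁; proj₂; Σ-syntax; ∃-syntax)
open import Data.Rational.Base as ℚ using (ℚ; mkℚ; _/_; 1ℚ; 0ℚ; ∣_∣; ↥_)
import Data.Rational.Properties as ℚ
import Data.Rational.Unnormalised.Base as ℚᵘ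
import Data.Rational.Unnormalised.Properties as ℚᵘ
open import Data.Vec.Functional using (Vector; []; _∷_; insertAt; reverse)
open import Function.Base using (_∘_; id)
open import Function.Bundles using (Bijection; Func)
open import Function.Definitions using (Injective)
open import Level using (_⊔_) renaming (suc to lsuc)
open import Relation.Binary.Bundles using (Setoid; DecSetoid)
open import Relation.Binary.PropositionalEquality as ≡ using (_≡_; _≢_; _≗_)
open import Relation.Nullary using (Dec; yes; no; ¬_)
open import Relation.Nullary.Decidable using (map′; _×-dec_; _→-dec_)

Matrix : ∀ {a} → Set a → ℕ → ℕ → Set a
Matrix A m n = Vector (Vector A n) m

module Matrices {c ℓ} (R : CommutativeRing c ℓ) where

  open CommutativeRing R public hiding (zero)
  open import Algebra.Properties.Semiring.Sum semiring public
  open import Algebra.Properties.Semiring.Exp semiring public using (_^_)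

  Mat : ℕ → ℕ → Set c
  Mat = Matrix Carrier

  infix  4 _≋_
  infixl 7 _·_

  record _≋_ {m n} (A B : Mat m n) : Set ℓ where
    constructor entrywise
    field
      at : ∀ i j → A i j ≈ B i j
  open _≋_ public

  _·_ : ∀ {m n p} → Mat m n → Mat n p → Mat m p
  _·_ {n = n} A B i j = ∑[ k < n ] (A i k * B k j)

  diagonal : ∀ {n} → Vector Carrier n → Mat n n
  diagonal t i j with i Fin.≟ j
  ... | yes _ = t i
  ... | no  _ = 0#

  sign : ∀ {n} → Fin n → Carrier
  sign k = (- 1#) ^ toℕ k

  -- Row 0 and column j are deleted.
  minor : ∀ {m n} → Mat (suc m) (suc n) → Fin (suc n) → Mat m n
  minor A j i k = A (suc i) (punchIn j k)

  -- Laplace expansion along row 0.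
  det : ∀ {n} → Mat n n → Carrier
  det {zero}  A = 1#
  det {suc n} A = ∑[ j < suc n ] (sign j * (A zero j * det (minor A j)))

  record Unipotent {n} (A : Mat n n) : Set (c ⊔ ℓ) where
    constructor unipotent
    field
      diag  : ∀ i → A i i ≈ 1#
      below : ∀ {i j} → j Fin.< i → A i j ≈ 0#
  open Unipotent public

  open import Relation.Binary.Reasoning.Setoid setoid
  open import Algebra.Solver.Ring.NaturalCoefficients.Default commutativeSemiring

  sum-zero : ∀ {n} {t : Vector Carrier n} → (∀ i → t i ≈ 0#) → sum t ≈ 0#
  sum-zero {n} p = trans (sum-cong-≋ p) (sum-replicate-zero n)

  sum-single : ∀ {n} {t : Vector Carrier n} i → (∀ j → j ≢ i → t j ≈ 0#) → sum t ≈ t i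
  sum-single zero p = trans (+-congˡ (sum-zero (λ j → p (suc j) λ ()))) (+-identityʳ _)
  sum-single (suc i) p = trans
    (+-cong (p zero λ ()) (sum-single i λ j j≢i → p (suc j) (j≢i ∘ Fin.suc-injective)))
    (+-identityˡ _)

  zero-* : ∀ {x y} → x ≈ 0# → x * y ≈ 0#
  zero-* p = trans (*-congʳ p) (zeroˡ _)

  *-zero : ∀ {x y} → y ≈ 0# → x * y ≈ 0#
  *-zero p = trans (*-congˡ p) (zeroʳ _)

  ≋-refl : ∀ {m n} {A : Mat m n} → A ≋ A
  ≋-refl .at i j = refl

  ≋-sym : ∀ {m n} {A B : Mat m n} → A ≋ B → B ≋ A
  ≋-sym p .at i j = sym (p .at i j)

  ≋-trans : ∀ {m n} {A B C : Mat m n} → A ≋ B → B ≋ C → A ≋ C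
  ≋-trans p q .at i j = trans (p .at i j) (q .at i j)

  ·-cong : ∀ {m n p} {A A′ : Mat m n} {B B′ : Mat n p} → A ≋ A′ → B ≋ B′ → A · B ≋ A′ · B′
  ·-cong p q .at i j = sum-cong-≋ λ k → *-cong (p .at i k) (q .at k j)

  ·-assoc : ∀ {m n p q} (A : Mat m n) (B : Mat n p) (C : Mat p q) → (A · B) · C ≋ A · (B · C)
  ·-assoc {n = n} {p} A B C .at i j = begin
    ∑[ l < p ] (∑[ k < n ] (A i k * B k l) * C l j)     ≈⟨ sum-cong-≋ (λ l → *-distribʳ-sum (C l j) (λ k → A i k * B k l)) ⟩
    ∑[ l < p ] ∑[ k < n ] (A i k * B k l * C l j)       ≈⟨ ∑-comm (λ l k → A i k * B k l * C l j) ⟩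
    ∑[ k < n ] ∑[ l < p ] (A i k * B k l * C l j)       ≈⟨ sum-cong-≋ (λ k → sum-cong-≋ λ l → *-assoc (A i k) (B k l) (C l j)) ⟩
    ∑[ k < n ] ∑[ l < p ] (A i k * (B k l * C l j))     ≈⟨ sum-cong-≋ (λ k → *-distribˡ-sum (A i k) (λ l → B k l * C l j)) ⟨
    ∑[ k < n ] (A i k * ∑[ l < p ] (B k l * C l j))     ∎

  1ᴹ : ∀ {n} → Mat n n
  1ᴹ = diagonal (λ _ → 1#)

  diagonal-≡ : ∀ {n} (t : Vector Carrier n) i → diagonal t i i ≈ t i
  diagonal-≡ t i with i Fin.≟ i
  ... | yes _ = refl
  ... | no i≢i = ⊥-elim (i≢i ≡.refl)

  diagonal-≢ : ∀ {n} (t : Vector Carrier n) {i j} → i ≢ j → diagonal t i j ≈ 0#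
  diagonal-≢ t {i} {j} i≢j with i Fin.≟ j
  ... | yes i≡j = ⊥-elim (i≢j i≡j)
  ... | no _ = refl

  ·-diagonalˡ : ∀ {m n} (t : Vector Carrier m) (A : Mat m n) i j → (diagonal t · A) i j ≈ t i * A i j
  ·-diagonalˡ t A i j = trans
    (sum-single i λ k k≢i → zero-* (diagonal-≢ t (k≢i ∘ ≡.sym)))
    (*-congʳ (diagonal-≡ t i))

  ·-identityˡ : ∀ {m n} (A : Mat m n) → 1ᴹ · A ≋ A
  ·-identityˡ A .at i j = trans (·-diagonalˡ _ A i j) (*-identityˡ _)

  ·-identityʳ : ∀ {m n} (A : Mat m n) → A · 1ᴹ ≋ A
  ·-identityʳ A .at i j = trans
    (sum-single j λ k k≢j → *-zero (diagonal-≢ _ k≢j))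
    (trans (*-congˡ (diagonal-≡ _ j)) (*-identityʳ _))

  1ᴹ-unipotent : ∀ {n} → Unipotent (1ᴹ {n})
  1ᴹ-unipotent .diag i = diagonal-≡ _ i
  1ᴹ-unipotent .below j<i = diagonal-≢ _ λ i≡j → Fin.<⇒≢ j<i (≡.sym i≡j)

  unipotent-cong : ∀ {n} {A B : Mat n n} → A ≋ B → Unipotent A → Unipotent B
  unipotent-cong p u .diag i = trans (sym (p .at i i)) (u .diag i)
  unipotent-cong p u .below j<i = trans (sym (p .at _ _)) (u .below j<i)

  unipotent-tail : ∀ {n} {A : Mat (suc n) (suc n)} → Unipotent A → Unipotent (λ i j → A (suc i) (suc j))
  unipotent-tail u .diag i = u .diag (suc i)
  unipotent-tail u .below j<i = u .below (s≤s j<i)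

  ·-unipotent : ∀ {n} {A B : Mat n n} → Unipotent A → Unipotent B → Unipotent (A · B)
  ·-unipotent {A = A} {B} u v .diag i = trans
    (sum-single i off)
    (trans (*-cong (u .diag i) (v .diag i)) (*-identityˡ 1#))
    where
    off : ∀ k → k ≢ i → A i k * B k i ≈ 0#
    off k k≢i with k Fin.<? i
    ... | yes k<i = zero-* (u .below k<i)
    ... | no  k≮i = *-zero (v .below (Fin.≤∧≢⇒< (ℕ.≮⇒≥ k≮i) (k≢i ∘ ≡.sym)))
  ·-unipotent {A = A} {B} u v .below {i} {j} j<i = sum-zero off
    where
    off : ∀ k → A i k * B k j ≈ 0#
    off k with k Fin.<? i
    ... | yes k<i = zero-* (u .below k<i)
    ... | no  k≮i = *-zero (v .below (ℕ.<-≤-trans j<i (ℕ.≮⇒≥ k≮i)))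

  -- Superdiagonal entries are additive on unipotent matrices.
  superdiagonal-· : ∀ {n} {A B : Mat (suc n) (suc n)} → Unipotent A → Unipotent B → ∀ i →
    (A · B) (Fin.inject₁ i) (suc i) ≈ A (Fin.inject₁ i) (suc i) + B (Fin.inject₁ i) (suc i)
  superdiagonal-· {suc n} {A} {B} u v zero = begin
    A zero zero * B zero (suc zero) + (A zero (suc zero) * B (suc zero) (suc zero) + sum (λ k → A zero (suc (suc k)) * B (suc (suc k)) (suc zero)))
      ≈⟨ +-cong (*-congʳ (u .diag zero)) (+-cong (*-congˡ (v .diag (suc zero))) (sum-zero {t = λ k → A zero (suc (suc k)) * B (suc (suc k)) (suc zero)} λ k → *-zero (v .below (s≤s (s≤s z≤n))))) ⟩
    1# * B zero (suc zero) + (A zero (suc zero) * 1# + 0#)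
      ≈⟨ solve 2 (λ b a → con 1 :* b :+ (a :* con 1 :+ con 0) := a :+ b) refl (B zero (suc zero)) (A zero (suc zero)) ⟩
    A zero (suc zero) + B zero (suc zero) ∎
  superdiagonal-· {suc n} {A} {B} u v (suc i) = trans
    (+-cong (zero-* (u .below (s≤s z≤n))) refl)
    (trans (+-identityˡ _) (superdiagonal-· (unipotent-tail u) (unipotent-tail v) i))

  inv : ∀ {n} → Mat n n → Mat n n
  inv {suc n} A zero    zero    = 1#
  inv {suc n} A zero    (suc j) = - (sum λ k → A zero (suc k) * inv (λ i j → A (suc i) (suc j)) k j)
  inv {suc n} A (suc i) zero    = 0#
  inv {suc n} A (suc i) (suc j) = inv (λ i j → A (suc i) (suc j)) i j

  inv-unipotent : ∀ {n} (A : Mat n n) → Unipotent (inv A)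
  inv-unipotent {suc n} A .diag zero = refl
  inv-unipotent {suc n} A .diag (suc i) = inv-unipotent (λ i j → A (suc i) (suc j)) .diag i
  inv-unipotent {suc n} A .below {suc i} {zero} _ = refl
  inv-unipotent {suc n} A .below {suc i} {suc j} (s≤s p) = inv-unipotent (λ i j → A (suc i) (suc j)) .below p

  ·-inverseʳ : ∀ {n} {A : Mat n n} → Unipotent A → A · inv A ≋ 1ᴹ
  ·-inverseʳ {suc n} {A} u .at zero zero = trans
    (+-cong (trans (*-identityʳ _) (u .diag zero)) (sum-zero λ k → zeroʳ (A zero (suc k))))
    (trans (+-identityʳ 1#) (sym (diagonal-≡ (λ (_ : Fin (suc n)) → 1#) zero)))
  ·-inverseʳ {suc n} {A} u .at zero (suc j) = begin
    A zero zero * - s + s ≈⟨ +-congʳ (trans (*-congʳ (u .diag zero)) (*-identityˡ _)) ⟩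
    - s + s               ≈⟨ -‿inverseˡ s ⟩
    0#                    ≈⟨ diagonal-≢ (λ _ → 1#) {zero} {suc j} (λ ()) ⟨
    1ᴹ zero (suc j)       ∎
    where s = sum λ k → A zero (suc k) * inv (λ i j → A (suc i) (suc j)) k j
  ·-inverseʳ {suc n} {A} u .at (suc i) zero = trans
    (+-cong (zero-* (u .below (s≤s z≤n))) (sum-zero λ k → zeroʳ (A (suc i) (suc k))))
    (trans (+-identityˡ 0#) (sym (diagonal-≢ (λ _ → 1#) {suc i} {zero} (λ ()))))
  ·-inverseʳ {suc n} {A} u .at (suc i) (suc j) = trans
    (+-cong (zero-* (u .below (s≤s z≤n))) (·-inverseʳ (unipotent-tail u) .at i j))
    (trans (+-identityˡ _) (1ᴹ-tail i j))
    where
    1ᴹ-tail : ∀ i j → 1ᴹ {n} i j ≈ 1ᴹ (suc i) (suc j)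
    1ᴹ-tail i j = go (i Fin.≟ j)
      where
      go : Dec (i ≡ j) → 1ᴹ {n} i j ≈ 1ᴹ (suc i) (suc j)
      go (yes ≡.refl) = trans (diagonal-≡ _ i) (sym (diagonal-≡ _ (suc i)))
      go (no i≢j) = trans (diagonal-≢ _ i≢j) (sym (diagonal-≢ _ (i≢j ∘ Fin.suc-injective)))

  -- In a monoid, an element with a right inverse that itself has a right
  -- inverse is invertible.
  ·-inverseˡ : ∀ {n} {A : Mat n n} → Unipotent A → inv A · A ≋ 1ᴹ
  ·-inverseˡ {A = A} u =
    ≋-trans (·-cong ≋-refl A≋inv²) (·-inverseʳ (inv-unipotent A))
    where
    A≋inv² : A ≋ inv (inv A)
    A≋inv² = ≋-trans (≋-sym (·-identityʳ A))
      (≋-trans (·-cong ≋-refl (≋-sym (·-inverseʳ (inv-unipotent A))))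
      (≋-trans (≋-sym (·-assoc A (inv A) (inv (inv A))))
      (≋-trans (·-cong (·-inverseʳ u) ≋-refl) (·-identityˡ _))))

  ·-assoc₅ : ∀ {n} (U L W M V : Mat n n) → U · (L · W · M) · V ≋ (U · L) · W · (M · V)
  ·-assoc₅ U L W M V =
    ≋-trans (·-cong (≋-sym (≋-trans (·-cong (·-assoc U L W) ≋-refl) (·-assoc U (L · W) M))) ≋-refl)
    (·-assoc (U · L · W) M V)

-- Multiplicativity of det, by row operations.
module Determinants {c ℓ} (R : CommutativeRing c ℓ) where

  open Matrices R
  open import Relation.Binary.Reasoning.Setoid setoid
  open import Algebra.Properties.Ring ring using (-1*x≈-x; -‿involutive)
  open import Algebra.Solver.Ring.NaturalCoefficients.Default commutativeSemiring

  private
    m : Carrier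
    m = - 1#

    mm : m * m ≈ 1#
    mm = trans (-1*x≈-x m) (-‿involutive 1#)

    x+mx : ∀ x → x + m * x ≈ 0#
    x+mx x = trans (+-congˡ (-1*x≈-x x)) (-‿inverseʳ x)

    cancel-m : ∀ {x y} → m * x ≈ m * y → x ≈ y
    cancel-m {x} {y} p = begin
      x           ≈⟨ *-identityˡ x ⟨
      1# * x      ≈⟨ *-congʳ mm ⟨
      m * m * x   ≈⟨ *-assoc m m x ⟩
      m * (m * x) ≈⟨ *-congˡ p ⟩
      m * (m * y) ≈⟨ *-assoc m m y ⟨
      m * m * y   ≈⟨ *-congʳ mm ⟩
      1# * y      ≈⟨ *-identityˡ y ⟩
      y           ∎

  det-cong : ∀ {n} {A B : Mat n n} → A ≋ B → det A ≈ det B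
  det-cong {zero}  p = refl
  det-cong {suc n} p = sum-cong-≋ λ j → *-congˡ {sign j}
    (*-cong (p .at zero j) (det-cong (entrywise λ i k → p .at (suc i) (punchIn j k))))

  private
    Cofactor : ℕ → Set c
    Cofactor n = (Fin n → Fin (suc (suc n))) → Carrier

    Extensional : ∀ {n} → Cofactor n → Set ℓ
    Extensional f = ∀ {g h} → g ≗ h → f g ≈ f h

    -- The expansion of a determinant along its first two rows.
    expand₂ : ∀ {n} → Vector Carrier (suc (suc n)) → Vector Carrier (suc (suc n)) → Cofactor n → Carrier
    expand₂ {n} x y f = ∑[ j < suc (suc n) ] (sign j * (x j *
      ∑[ l < suc n ] (sign l * (y (punchIn j l) * f (punchIn j ∘ punchIn l)))))

    module _ {n} (f : Cofactor n) where

      head₂ : Vector Carrier (suc (suc n)) → Carrier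
      head₂ y = ∑[ l < suc n ] (sign l * (y (suc l) * f (suc ∘ punchIn l)))

      rest : Vector Carrier (suc (suc n)) → Vector Carrier (suc (suc n)) → Carrier
      rest x y = ∑[ j < suc n ] (sign j * (x (suc j) *
        ∑[ l < n ] (sign l * (y (suc (punchIn j l)) * f (punchIn (suc j) ∘ punchIn (suc l))))))

      expand₂-split : ∀ x y → expand₂ x y f ≈ x zero * head₂ y + (m * (y zero * head₂ x) + rest x y)
      expand₂-split x y = +-cong (*-identityˡ _) (begin
        ∑[ j < suc n ] (m * sign j * (x (suc j) * (1# * (y zero * f₁ j) + ∑[ l < n ] (m * sign l * w j l))))
          ≈⟨ sum-cong-≋ (λ j → *-congˡ {m * sign j} (*-congˡ {x (suc j)} (+-congˡ {1# * (y zero * f₁ j)} (pull j)))) ⟩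
        ∑[ j < suc n ] (m * sign j * (x (suc j) * (1# * (y zero * f₁ j) + m * r j)))
          ≈⟨ sum-cong-≋ (λ j → arith m (sign j) (x (suc j)) (y zero) (f₁ j) (r j)) ⟩
        ∑[ j < suc n ] (m * y zero * (sign j * (x (suc j) * f₁ j)) + m * m * (sign j * (x (suc j) * r j)))
          ≈⟨ sum-cong-≋ (λ j → +-congˡ {m * y zero * (sign j * (x (suc j) * f₁ j))} (trans (*-congʳ mm) (*-identityˡ (sign j * (x (suc j) * r j))))) ⟩
        ∑[ j < suc n ] (m * y zero * (sign j * (x (suc j) * f₁ j)) + sign j * (x (suc j) * r j))
          ≈⟨ ∑-distrib-+ (λ j → m * y zero * (sign j * (x (suc j) * f₁ j))) (λ j → sign j * (x (suc j) * r j)) ⟩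
        ∑[ j < suc n ] (m * y zero * (sign j * (x (suc j) * f₁ j))) + rest x y
          ≈⟨ +-congʳ (*-distribˡ-sum (m * y zero) (λ j → sign j * (x (suc j) * f₁ j))) ⟨
        m * y zero * head₂ x + rest x y
          ≈⟨ +-congʳ (*-assoc m (y zero) (head₂ x)) ⟩
        m * (y zero * head₂ x) + rest x y ∎)
        where
        f₁ : Fin (suc n) → Carrier
        f₁ j = f (suc ∘ punchIn j)
        w : Fin (suc n) → Fin n → Carrier
        w j l = y (suc (punchIn j l)) * f (punchIn (suc j) ∘ punchIn (suc l))
        r : Fin (suc n) → Carrier
        r j = ∑[ l < n ] (sign l * w j l)
        pull : ∀ j → ∑[ l < n ] (m * sign l * w j l) ≈ m * r j
        pull j = trans (sum-cong-≋ λ l → *-assoc m (sign l) (w j l))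
                       (sym (*-distribˡ-sum m (λ l → sign l * w j l)))
        arith : ∀ m s x y f r → m * s * (x * (1# * (y * f) + m * r)) ≈ m * y * (s * (x * f)) + m * m * (s * (x * r))
        arith = solve 6 (λ m s x y f r →
          m :* s :* (x :* (con 1 :* (y :* f) :+ m :* r)) := m :* y :* (s :* (x :* f)) :+ m :* m :* (s :* (x :* r))) refl

    lift : ∀ {k n} → (Fin k → Fin n) → Fin (suc k) → Fin (suc n)
    lift g zero    = zero
    lift g (suc k) = suc (g k)

    lift-cong : ∀ {k n} {g h : Fin k → Fin n} → g ≗ h → lift g ≗ lift h
    lift-cong p zero    = ≡.refl
    lift-cong p (suc k) = ≡.cong suc (p k)

    rest-suc : ∀ {n} (f : Cofactor (suc n)) → Extensional f → ∀ x y →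
      rest f x y ≈ expand₂ (x ∘ suc) (y ∘ suc) (f ∘ lift)
    rest-suc f f-ext x y = sum-cong-≋ λ j → *-congˡ {sign j} (*-congˡ {x (suc j)} (sum-cong-≋ λ l →
      *-congˡ {sign l} (*-congˡ {y (suc (punchIn j l))} (f-ext {punchIn (suc j) ∘ punchIn (suc l)} {lift (punchIn j ∘ punchIn l)} λ { zero → ≡.refl ; (suc k) → ≡.refl }))))

    expand₂-anti : ∀ {n} (f : Cofactor n) → Extensional f → ∀ x y → expand₂ x y f ≈ m * expand₂ y x f
    rest-anti : ∀ {n} (f : Cofactor n) → Extensional f → ∀ x y → rest f x y ≈ m * rest f y x

    expand₂-anti f f-ext x y = begin
      expand₂ x y f
        ≈⟨ expand₂-split f x y ⟩
      x zero * head₂ f y + (m * (y zero * head₂ f x) + rest f x y)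
        ≈⟨ +-cong (trans (sym (*-identityˡ _)) (*-congʳ (sym mm))) (+-congˡ (rest-anti f f-ext x y)) ⟩
      m * m * (x zero * head₂ f y) + (m * (y zero * head₂ f x) + m * rest f y x)
        ≈⟨ solve 4 (λ m a b r → m :* m :* a :+ (m :* b :+ m :* r) := m :* (b :+ (m :* a :+ r))) refl m _ _ _ ⟩
      m * (y zero * head₂ f x + (m * (x zero * head₂ f y) + rest f y x))
        ≈⟨ *-congˡ (expand₂-split f y x) ⟨
      m * expand₂ y x f ∎
    rest-anti {zero} f f-ext x y = begin
      rest f x y     ≈⟨ zero-rest x y ⟩
      0#             ≈⟨ zeroʳ m ⟨
      m * 0#         ≈⟨ *-congˡ (zero-rest y x) ⟨
      m * rest f y x ∎
      where
      zero-rest : ∀ x y → rest f x y ≈ 0#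
      zero-rest x y = solve 2 (λ a b → a :* (b :* con 0) :+ con 0 := con 0) refl (sign {1} zero) (x (suc zero))
    rest-anti {suc n} f f-ext x y = begin
      rest f x y                                      ≈⟨ rest-suc f f-ext x y ⟩
      expand₂ (x ∘ suc) (y ∘ suc) (f ∘ lift)          ≈⟨ expand₂-anti (f ∘ lift) (f-ext ∘ lift-cong) (x ∘ suc) (y ∘ suc) ⟩
      m * expand₂ (y ∘ suc) (x ∘ suc) (f ∘ lift)      ≈⟨ *-congˡ (rest-suc f f-ext y x) ⟨
      m * rest f y x                                  ∎

    expand₂-alt : ∀ {n} (f : Cofactor n) → Extensional f → ∀ x → expand₂ x x f ≈ 0#
    rest-alt : ∀ {n} (f : Cofactor n) → Extensional f → ∀ x → rest f x x ≈ 0#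

    expand₂-alt f f-ext x = begin
      expand₂ x x f
        ≈⟨ expand₂-split f x x ⟩
      x zero * head₂ f x + (m * (x zero * head₂ f x) + rest f x x)
        ≈⟨ +-assoc _ _ _ ⟨
      x zero * head₂ f x + m * (x zero * head₂ f x) + rest f x x
        ≈⟨ +-cong (x+mx _) (rest-alt f f-ext x) ⟩
      0# + 0#
        ≈⟨ +-identityˡ 0# ⟩
      0# ∎
    rest-alt {zero} f f-ext x = solve 2 (λ a b → a :* (b :* con 0) :+ con 0 := con 0) refl (sign {1} zero) (x (suc zero))
    rest-alt {suc n} f f-ext x = trans (rest-suc f f-ext x x) (expand₂-alt (f ∘ lift) (f-ext ∘ lift-cong) (x ∘ suc))

    ∷-cong : ∀ {k n} {x y : Vector Carrier n} {X Y : Mat k n} → (∀ j → x j ≈ y j) → X ≋ Y → (x ∷ X) ≋ (y ∷ Y)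
    ∷-cong p q .at zero    = p
    ∷-cong p q .at (suc i) = q .at i

  module _ {n} (x y : Vector Carrier (suc (suc n))) (X : Mat n (suc (suc n))) where

    f-rows : Cofactor n
    f-rows g = det (λ i k → X i (g k))

    f-rows-ext : Extensional f-rows
    f-rows-ext p = det-cong (entrywise λ i k → reflexive (≡.cong (X i) (p k)))

    det-swap : det (x ∷ y ∷ X) ≈ m * det (y ∷ x ∷ X)
    det-swap = expand₂-anti f-rows f-rows-ext x y

    det-alt : det (x ∷ x ∷ X) ≈ 0#
    det-alt = expand₂-alt f-rows f-rows-ext x

  det-linear : ∀ {n} (x y : Vector Carrier (suc n)) t (X : Mat n (suc n)) →
    det ((λ j → y j + t * x j) ∷ X) ≈ det (y ∷ X) + t * det (x ∷ X)
  det-linear {n} x y t X = begin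
    ∑[ j < suc n ] (sign j * ((y j + t * x j) * d j))
      ≈⟨ sum-cong-≋ (λ j → solve 5 (λ s y t x d → s :* ((y :+ t :* x) :* d) := s :* (y :* d) :+ t :* (s :* (x :* d))) refl (sign j) (y j) t (x j) (d j)) ⟩
    ∑[ j < suc n ] (sign j * (y j * d j) + t * (sign j * (x j * d j)))
      ≈⟨ ∑-distrib-+ (λ j → sign j * (y j * d j)) (λ j → t * (sign j * (x j * d j))) ⟩
    det (y ∷ X) + ∑[ j < suc n ] (t * (sign j * (x j * d j)))
      ≈⟨ +-congˡ (*-distribˡ-sum t (λ j → sign j * (x j * d j))) ⟨
    det (y ∷ X) + t * det (x ∷ X) ∎
    where
    d : Fin (suc n) → Carrier
    d j = det (minor (x ∷ X) j)

  -- Adding multiples of the top row to the other rows.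
  det-shear : ∀ {n} (x : Vector Carrier (suc n)) (X : Mat n (suc n)) (s : Vector Carrier n) →
    det (x ∷ λ i j → X i j + s i * x j) ≈ det (x ∷ X)
  det-shear {zero}  x X s = det-cong {A = x ∷ λ i j → X i j + s i * x j} {x ∷ X} (entrywise λ { zero j → refl })
  det-shear {suc n} x X s = cancel-m (begin
    m * det (x ∷ X′)                    ≈⟨ *-congˡ (det-cong {A = x ∷ X′} {x ∷ y′ ∷ Y′} (entrywise λ { zero j → refl ; (suc zero) j → refl ; (suc (suc i)) j → refl })) ⟩
    m * det (x ∷ y′ ∷ Y′)               ≈⟨ det-swap y′ x Y′ ⟨
    det (y′ ∷ x ∷ Y′)                   ≈⟨ det-linear x y (s zero) (x ∷ Y′) ⟩
    det (y ∷ x ∷ Y′) + s zero * det (x ∷ x ∷ Y′)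
                                        ≈⟨ +-congˡ (*-zero (det-alt x x Y′)) ⟩
    det (y ∷ x ∷ Y′) + 0#               ≈⟨ +-identityʳ _ ⟩
    det (y ∷ x ∷ Y′)                    ≈⟨ sum-cong-≋ (λ j → *-congˡ {sign j} (*-congˡ {y j} (minors j))) ⟩
    det (y ∷ x ∷ Y)                     ≈⟨ det-swap y x Y ⟩
    m * det (x ∷ y ∷ Y)                 ≈⟨ *-congˡ (det-cong {A = x ∷ y ∷ Y} {x ∷ X} (entrywise λ { zero j → refl ; (suc zero) j → refl ; (suc (suc i)) j → refl })) ⟩
    m * det (x ∷ X)                     ∎)
    where
    X′ = λ i j → X i j + s i * x j
    y y′ : Vector Carrier (suc (suc n))
    y = X zero
    y′ = X′ zero
    Y Y′ : Mat n (suc (suc n))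
    Y i = X (suc i)
    Y′ i = X′ (suc i)
    minors : ∀ j → det (minor (y ∷ x ∷ Y′) j) ≈ det (minor (y ∷ x ∷ Y) j)
    minors j = begin
      det (minor (y ∷ x ∷ Y′) j)
        ≈⟨ det-cong {A = minor (y ∷ x ∷ Y′) j} {(x ∘ punchIn j) ∷ λ i k → Y i (punchIn j k) + s (suc i) * x (punchIn j k)} (entrywise λ { zero k → refl ; (suc i) k → refl }) ⟩
      det ((x ∘ punchIn j) ∷ λ i k → Y i (punchIn j k) + s (suc i) * x (punchIn j k))
        ≈⟨ det-shear (x ∘ punchIn j) (λ i → Y i ∘ punchIn j) (s ∘ suc) ⟩
      det ((x ∘ punchIn j) ∷ λ i → Y i ∘ punchIn j)
        ≈⟨ det-cong {A = minor (y ∷ x ∷ Y) j} {(x ∘ punchIn j) ∷ λ i → Y i ∘ punchIn j} (entrywise λ { zero k → refl ; (suc i) k → refl }) ⟨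
      det (minor (y ∷ x ∷ Y) j) ∎

  -- Moving row k to the top.
  det-rotate : ∀ {n} (A : Mat (suc n) (suc n)) k →
    det A ≈ sign k * det (A k ∷ (A ∘ punchIn k))
  det-rotate A zero = trans (det-cong {A = A} {A zero ∷ (A ∘ suc)} (entrywise λ { zero j → refl ; (suc i) j → refl })) (sym (*-identityˡ _))
  det-rotate {suc n} A (suc k) = begin
    det A
      ≈⟨ sum-cong-≋ (λ j → *-congˡ {sign j} (*-congˡ {A zero j} (det-rotate (minor A j) k))) ⟩
    ∑[ j < suc (suc n) ] (sign j * (A zero j * (sign k * det (minor A j k ∷ (minor A j ∘ punchIn k)))))
      ≈⟨ sum-cong-≋ (λ j → solve 4 (λ s a t d → s :* (a :* (t :* d)) := t :* (s :* (a :* d))) refl (sign j) (A zero j) (sign k) (det (minor A j k ∷ (minor A j ∘ punchIn k)))) ⟩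
    ∑[ j < suc (suc n) ] (sign k * (sign j * (A zero j * det (minor A j k ∷ (minor A j ∘ punchIn k)))))
      ≈⟨ *-distribˡ-sum (sign k) (λ j → sign j * (A zero j * det (minor A j k ∷ (minor A j ∘ punchIn k)))) ⟨
    sign k * (∑[ j < suc (suc n) ] (sign j * (A zero j * det (minor A j k ∷ (minor A j ∘ punchIn k)))))
      ≈⟨ *-congˡ (sum-cong-≋ λ j → *-congˡ {sign j} (*-congˡ {A zero j} (det-cong {A = minor A j k ∷ (minor A j ∘ punchIn k)} {minor (A zero ∷ A (suc k) ∷ A′) j} (entrywise λ { zero i → refl ; (suc l) i → refl })))) ⟩
    sign k * det (A zero ∷ A (suc k) ∷ A′)
      ≈⟨ *-congˡ (det-swap (A zero) (A (suc k)) A′) ⟩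
    sign k * (m * det (A (suc k) ∷ A zero ∷ A′))
      ≈⟨ solve 3 (λ s m d → s :* (m :* d) := m :* s :* d) refl (sign k) m _ ⟩
    m * sign k * det (A (suc k) ∷ A zero ∷ A′)
      ≈⟨ *-congˡ (det-cong {A = A (suc k) ∷ A zero ∷ A′} {A (suc k) ∷ (A ∘ punchIn (suc k))} (entrywise λ { zero j → refl ; (suc zero) j → refl ; (suc (suc i)) j → refl })) ⟩
    sign (suc k) * det (A (suc k) ∷ (A ∘ punchIn (suc k))) ∎
    where
    A′ : Mat n (suc (suc n))
    A′ i = A (suc (punchIn k i))

  det-· : ∀ {n} (A B : Mat n n) → det (A · B) ≈ det A * det B
  det-· {zero} A B = sym (*-identityˡ 1#)
  det-· {suc n} A B = begin
    ∑[ j < suc n ] (sign j * ((∑[ k < suc n ] (A zero k * B k j)) * d j))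
      ≈⟨ sum-cong-≋ (λ j → distr j) ⟩
    ∑[ j < suc n ] ∑[ k < suc n ] (A zero k * (sign j * (B k j * d j)))
      ≈⟨ ∑-comm (λ j k → A zero k * (sign j * (B k j * d j))) ⟩
    ∑[ k < suc n ] ∑[ j < suc n ] (A zero k * (sign j * (B k j * d j)))
      ≈⟨ sum-cong-≋ (λ k → sym (*-distribˡ-sum (A zero k) (λ j → sign j * (B k j * d j)))) ⟩
    ∑[ k < suc n ] (A zero k * det (B k ∷ (A′ · B)))
      ≈⟨ sum-cong-≋ (λ k → *-congˡ {A zero k} (clear k)) ⟩
    ∑[ k < suc n ] (A zero k * det (B k ∷ (A″ k · (B ∘ punchIn k))))
      ≈⟨ sum-cong-≋ (λ k → *-congˡ {A zero k} (row k)) ⟩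
    ∑[ k < suc n ] (A zero k * (det (A″ k) * det (B k ∷ (B ∘ punchIn k))))
      ≈⟨ sum-cong-≋ (λ k → *-congˡ {A zero k} (*-congˡ {det (A″ k)} (unrotate k))) ⟩
    ∑[ k < suc n ] (A zero k * (det (A″ k) * (sign k * det B)))
      ≈⟨ sum-cong-≋ (λ k → solve 4 (λ a d s b → a :* (d :* (s :* b)) := s :* (a :* d) :* b) refl (A zero k) (det (A″ k)) (sign k) (det B)) ⟩
    ∑[ k < suc n ] (sign k * (A zero k * det (A″ k)) * det B)
      ≈⟨ *-distribʳ-sum (det B) (λ k → sign k * (A zero k * det (A″ k))) ⟨
    det A * det B ∎
    where
    A′ : Mat n (suc n)
    A′ i = A (suc i)
    A″ : Fin (suc n) → Mat n n
    A″ k = minor A k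
    d : Fin (suc n) → Carrier
    d j = det (minor (A · B) j)
    distr : ∀ j → sign j * ((∑[ k < suc n ] (A zero k * B k j)) * d j) ≈
                  ∑[ k < suc n ] (A zero k * (sign j * (B k j * d j)))
    distr j = begin
      sign j * ((∑[ k < suc n ] (A zero k * B k j)) * d j)
        ≈⟨ *-congˡ (*-distribʳ-sum (d j) (λ k → A zero k * B k j)) ⟩
      sign j * (∑[ k < suc n ] (A zero k * B k j * d j))
        ≈⟨ *-distribˡ-sum (sign j) (λ k → A zero k * B k j * d j) ⟩
      ∑[ k < suc n ] (sign j * (A zero k * B k j * d j))
        ≈⟨ sum-cong-≋ (λ k → solve 4 (λ s a b d → s :* (a :* b :* d) := a :* (s :* (b :* d))) refl (sign j) (A zero k) (B k j) (d j)) ⟩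
      ∑[ k < suc n ] (A zero k * (sign j * (B k j * d j))) ∎
    clear : ∀ k → det (B k ∷ (A′ · B)) ≈ det (B k ∷ (A″ k · (B ∘ punchIn k)))
    clear k = trans
      (det-cong (∷-cong {x = B k} {y = B k} (λ j → refl) (entrywise λ i j → trans
        (sum-remove {i = k} (λ l → A′ i l * B l j)) (+-comm _ _))))
      (det-shear (B k) (A″ k · (B ∘ punchIn k)) (λ i → A′ i k))
    row : ∀ k → det (B k ∷ (A″ k · (B ∘ punchIn k))) ≈ det (A″ k) * det (B k ∷ (B ∘ punchIn k))
    row k = begin
      ∑[ j < suc n ] (sign j * (B k j * det (A″ k · (λ i l → B (punchIn k i) (punchIn j l)))))
        ≈⟨ sum-cong-≋ (λ j → *-congˡ {sign j} (*-congˡ {B k j} (det-· (A″ k) (λ i l → B (punchIn k i) (punchIn j l))))) ⟩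
      ∑[ j < suc n ] (sign j * (B k j * (det (A″ k) * e j)))
        ≈⟨ sum-cong-≋ (λ j → solve 4 (λ s b a e → s :* (b :* (a :* e)) := a :* (s :* (b :* e))) refl (sign j) (B k j) (det (A″ k)) (e j)) ⟩
      ∑[ j < suc n ] (det (A″ k) * (sign j * (B k j * e j)))
        ≈⟨ *-distribˡ-sum (det (A″ k)) (λ j → sign j * (B k j * e j)) ⟨
      det (A″ k) * det (B k ∷ (B ∘ punchIn k)) ∎
      where
      e : Fin (suc n) → Carrier
      e j = det (λ i l → B (punchIn k i) (punchIn j l))
    unrotate : ∀ k → det (B k ∷ (B ∘ punchIn k)) ≈ sign k * det B
    unrotate k = begin
      r                     ≈⟨ *-identityˡ r ⟨
      1# * r                ≈⟨ *-congʳ (sign² (toℕ k)) ⟨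
      sign k * sign k * r   ≈⟨ *-assoc _ _ r ⟩
      sign k * (sign k * r) ≈⟨ *-congˡ (det-rotate B k) ⟨
      sign k * det B        ∎
      where
      r = det (B k ∷ (B ∘ punchIn k))
      sign² : ∀ i → m ^ i * m ^ i ≈ 1#
      sign² zero = *-identityˡ 1#
      sign² (suc i) = trans (solve 2 (λ m s → m :* s :* (m :* s) := m :* m :* (s :* s)) refl m (m ^ i))
        (trans (*-cong mm (sign² i)) (*-identityˡ 1#))

  det-zero-column : ∀ {n} (A : Mat (suc n) (suc n)) → (∀ i → A i zero ≈ 0#) → det A ≈ 0#
  det-zero-column A p = sum-zero {t = λ j → sign j * (A zero j * det (minor A j))} λ
    { zero → *-zero (zero-* (p zero))
    ; (suc j) → *-zero (*-zero (later A p j)) }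
    where
    later : ∀ {n} (A : Mat (suc n) (suc n)) → (∀ i → A i zero ≈ 0#) → ∀ j → det (minor A (suc j)) ≈ 0#
    later {suc n} A p j = det-zero-column (minor A (suc j)) (λ i → p (suc i))

  det-unipotent : ∀ {n} {A : Mat n n} → Unipotent A → det A ≈ 1#
  det-unipotent {zero} u = refl
  det-unipotent {suc n} {A} u = begin
    det A                                   ≈⟨ sum-single zero off ⟩
    1# * (A zero zero * det (minor A zero)) ≈⟨ *-identityˡ _ ⟩
    A zero zero * det (minor A zero)        ≈⟨ *-cong (u .diag zero) (det-unipotent (unipotent-tail u)) ⟩
    1# * 1#                                 ≈⟨ *-identityˡ 1# ⟩
    1#                                      ∎
    where
    zero-minor : ∀ {n} {A : Mat (suc n) (suc n)} → Unipotent A → ∀ j → det (minor A (suc j)) ≈ 0#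
    zero-minor {suc n} {A} u j = det-zero-column (minor A (suc j)) (λ i → u .below (s≤s z≤n))
    off : ∀ j → j ≢ zero → sign j * (A zero j * det (minor A j)) ≈ 0#
    off zero j≢0 with () ← j≢0 ≡.refl
    off (suc j) _ = *-zero (*-zero (zero-minor u j))

IsHomomorphism : ∀ {a ℓ₁ b ℓ₂} (R : CommutativeRing a ℓ₁) (S : CommutativeRing b ℓ₂) →
  (CommutativeRing.Carrier R → CommutativeRing.Carrier S) → Set _
IsHomomorphism R S = RingMorphisms.IsRingHomomorphism (CommutativeRing.rawRing R) (CommutativeRing.rawRing S)

module Homomorphism {a ℓ₁ b ℓ₂} (R : CommutativeRing a ℓ₁) (S : CommutativeRing b ℓ₂)
  (φ : CommutativeRing.Carrier R → CommutativeRing.Carrier S) (φ-hom : IsHomomorphism R S φ) where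

  private
    module R = Matrices R
    module S = Matrices S
    module φ = RingMorphisms.IsRingHomomorphism φ-hom

  image : ∀ {m n} → R.Mat m n → S.Mat m n
  image A i j = φ (A i j)

  sum-homo : ∀ {n} (t : Vector R.Carrier n) → φ (R.sum t) S.≈ S.sum (φ ∘ t)
  sum-homo {zero} t = φ.0#-homo
  sum-homo {suc n} t = S.trans (φ.+-homo _ _) (S.+-congˡ (sum-homo (t ∘ suc)))

  ·-homo : ∀ {m n p} (A : R.Mat m n) (B : R.Mat n p) → image (A R.· B) S.≋ image A S.· image B
  ·-homo A B .S.at i j = S.trans (sum-homo (λ k → A i k R.* B k j)) (S.sum-cong-≋ λ k → φ.*-homo (A i k) (B k j))

  image-cong : ∀ {m n} {A B : R.Mat m n} → A R.≋ B → image A S.≋ image B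
  image-cong p .S.at i j = φ.⟦⟧-cong (p .R.at i j)

  image-unipotent : ∀ {n} {A : R.Mat n n} → R.Unipotent A → S.Unipotent (image A)
  image-unipotent u .S.diag i = S.trans (φ.⟦⟧-cong (u .R.diag i)) φ.1#-homo
  image-unipotent u .S.below j<i = S.trans (φ.⟦⟧-cong (u .R.below j<i)) φ.0#-homo

  module _ (injective : Injective R._≈_ S._≈_ φ) where

    ≋-reflect : ∀ {m n} {A B : R.Mat m n} → image A S.≋ image B → A R.≋ B
    ≋-reflect p .R.at i j = injective (p .S.at i j)

    image-unipotent⁻¹ : ∀ {n} {A : R.Mat n n} → S.Unipotent (image A) → R.Unipotent A
    image-unipotent⁻¹ u .R.diag i = injective (S.trans (u .S.diag i) (S.sym φ.1#-homo))
    image-unipotent⁻¹ u .R.below j<i = injective (S.trans (u .S.below j<i) (S.sym φ.0#-homo))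

ℤ-ring = ℤ.+-*-commutativeRing
ℚ-ring = ℚ.+-*-commutativeRing

fromℤ : ℤ → ℚ
fromℤ z = z / 1

toℚᵘ-fromℤ : ∀ z → ℚ.toℚᵘ (fromℤ z) ℚᵘ.≃ ℚᵘ.mkℚᵘ z 0
toℚᵘ-fromℤ z = ℚ.toℚᵘ-fromℚᵘ (ℚᵘ.mkℚᵘ z 0)

↥-fromℤ : ∀ z → ℚ.↥ fromℤ z ≡ z
↥-fromℤ z = ≡.cong ℚ.↥_ (ℚ.fromℚᵘ-toℚᵘ (ℚ.mkℚ z 0 (Coprime.sym (Coprime.1-coprimeTo ℤ.∣ z ∣))))

private
  fromℤ-+ : ∀ x y → fromℤ (x ℤ.+ y) ≡ fromℤ x ℚ.+ fromℤ y
  fromℤ-+ x y = ℚ.toℚᵘ-injective (begin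
    ℚ.toℚᵘ (fromℤ (x ℤ.+ y))                    ≈⟨ toℚᵘ-fromℤ (x ℤ.+ y) ⟩
    ℚᵘ.mkℚᵘ (x ℤ.+ y) 0                         ≈⟨ ℚᵘ.*≡* (≡.cong (ℤ._* 1ℤ) (≡.sym (≡.cong₂ ℤ._+_ (ℤ.*-identityʳ x) (ℤ.*-identityʳ y)))) ⟩
    ℚᵘ.mkℚᵘ x 0 ℚᵘ.+ ℚᵘ.mkℚᵘ y 0                ≈⟨ ℚᵘ.+-cong (toℚᵘ-fromℤ x) (toℚᵘ-fromℤ y) ⟨
    ℚ.toℚᵘ (fromℤ x) ℚᵘ.+ ℚ.toℚᵘ (fromℤ y)      ≈⟨ ℚ.toℚᵘ-homo-+ (fromℤ x) (fromℤ y) ⟨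
    ℚ.toℚᵘ (fromℤ x ℚ.+ fromℤ y)                ∎)
    where open import Relation.Binary.Reasoning.Setoid ℚᵘ.≃-setoid

  fromℤ-* : ∀ x y → fromℤ (x ℤ.* y) ≡ fromℤ x ℚ.* fromℤ y
  fromℤ-* x y = ℚ.toℚᵘ-injective (begin
    ℚ.toℚᵘ (fromℤ (x ℤ.* y))                    ≈⟨ toℚᵘ-fromℤ (x ℤ.* y) ⟩
    ℚᵘ.mkℚᵘ x 0 ℚᵘ.* ℚᵘ.mkℚᵘ y 0                ≈⟨ ℚᵘ.*-cong (toℚᵘ-fromℤ x) (toℚᵘ-fromℤ y) ⟨
    ℚ.toℚᵘ (fromℤ x) ℚᵘ.* ℚ.toℚᵘ (fromℤ y)      ≈⟨ ℚ.toℚᵘ-homo-* (fromℤ x) (fromℤ y) ⟨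
    ℚ.toℚᵘ (fromℤ x ℚ.* fromℤ y)                ∎)
    where open import Relation.Binary.Reasoning.Setoid ℚᵘ.≃-setoid

  fromℤ-neg : ∀ x → fromℤ (ℤ.- x) ≡ ℚ.- fromℤ x
  fromℤ-neg x = ℚ.toℚᵘ-injective (begin
    ℚ.toℚᵘ (fromℤ (ℤ.- x))                      ≈⟨ toℚᵘ-fromℤ (ℤ.- x) ⟩
    ℚᵘ.- ℚᵘ.mkℚᵘ x 0                            ≈⟨ ℚᵘ.-‿cong (toℚᵘ-fromℤ x) ⟨
    ℚᵘ.- ℚ.toℚᵘ (fromℤ x)                       ≈⟨ ℚ.toℚᵘ-homo‿- (fromℤ x) ⟨
    ℚ.toℚᵘ (ℚ.- fromℤ x)                        ∎)
    where open import Relation.Binary.Reasoning.Setoid ℚᵘ.≃-setoid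

fromℤ-injective : ∀ {x y} → fromℤ x ≡ fromℤ y → x ≡ y
fromℤ-injective {x} {y} p with ℚᵘ.≃-trans (ℚᵘ.≃-sym (toℚᵘ-fromℤ x)) (ℚᵘ.≃-trans (ℚᵘ.≃-reflexive (≡.cong ℚ.toℚᵘ p)) (toℚᵘ-fromℤ y))
... | ℚᵘ.*≡* q = ≡.trans (≡.sym (ℤ.*-identityʳ x)) (≡.trans q (ℤ.*-identityʳ y))

fromℤ-isRingHomomorphism : IsHomomorphism ℤ-ring ℚ-ring fromℤ
fromℤ-isRingHomomorphism = record
  { isSemiringHomomorphism = record
    { isNearSemiringHomomorphism = record
      { +-isMonoidHomomorphism = record
        { isMagmaHomomorphism = record
          { isRelHomomorphism = record { cong = ≡.cong fromℤ }
          ; homo = fromℤ-+ }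
        ; ε-homo = ≡.refl }
      ; *-homo = fromℤ-* }
    ; 1#-homo = ≡.refl }
  ; -‿homo = fromℤ-neg }

-- Gaussian elimination A = L·d·V with prescribed pivots d, over ℚ.
module ℚᴹ = Matrices ℚ-ring
module ℤᴹ = Matrices ℤ-ring

open ℚᴹ using () renaming (Mat to Matℚ; Unipotent to Unipotentℚ)
open ℤᴹ using () renaming (Mat to Matℤ; Unipotent to Unipotentℤ)

schur : ∀ {n} → ℚ → Matℚ (suc n) (suc n) → Matℚ n n
schur p A i j = A (suc i) (suc j) ℚ.- A (suc i) zero ℚ.* p ℚ.* A zero (suc j)

lowerFactor : ∀ {n} → Vector ℚ n → Matℚ n n → Matℚ n n
lowerFactor d⁻¹ A zero    zero    = 1ℚ
lowerFactor d⁻¹ A zero    (suc j) = 0ℚ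
lowerFactor d⁻¹ A (suc i) zero    = A (suc i) zero ℚ.* d⁻¹ zero
lowerFactor d⁻¹ A (suc i) (suc j) = lowerFactor (d⁻¹ ∘ suc) (schur (d⁻¹ zero) A) i j

upperFactor : ∀ {n} → Vector ℚ n → Matℚ n n → Matℚ n n
upperFactor d⁻¹ A zero    j       = d⁻¹ zero ℚ.* A zero j
upperFactor d⁻¹ A (suc i) zero    = 0ℚ
upperFactor d⁻¹ A (suc i) (suc j) = upperFactor (d⁻¹ ∘ suc) (schur (d⁻¹ zero) A) i j

module Elimination {a ℓ} (S : CommutativeRing a ℓ)
  (ι : ℚ → CommutativeRing.Carrier S) (ι-hom : IsHomomorphism ℚ-ring S ι) where

  open Matrices S
  private module ι = RingMorphisms.IsRingHomomorphism ι-hom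
  open import Relation.Binary.Reasoning.Setoid setoid
  open import Algebra.Properties.Ring ring using (-‿distribˡ-*)
  open import Algebra.Solver.Ring.NaturalCoefficients.Default commutativeSemiring

  record Factorisation {n} (d : Vector ℚ n) (A : Matℚ n n) (L V : Mat n n) : Set ℓ where
    field
      L-diag  : ∀ i → L i i ≈ 1#
      L-above : ∀ {i j} → i Fin.< j → L i j ≈ 0#
      V-diag  : ∀ i → V i i ≈ 1#
      V-below : ∀ {i j} → j Fin.< i → V i j ≈ 0#
      product : ∀ i j → ι (A i j) ≈ ∑[ l < n ] (L i l * ι (d l) * V l j)

  module Step {n} {d d⁻¹ : Vector ℚ (suc n)} (dd⁻¹ : ∀ l → d l ℚ.* d⁻¹ l ≡ 1ℚ)
    {A : Matℚ (suc n) (suc n)} {L V : Mat (suc n) (suc n)} (F : Factorisation d A L V) where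
    open Factorisation F

    d₀ d₀⁻¹ : Carrier
    d₀ = ι (d zero)
    d₀⁻¹ = ι (d⁻¹ zero)

    cancel : d₀ * d₀⁻¹ ≈ 1#
    cancel = trans (sym (ι.*-homo _ _)) (trans (ι.⟦⟧-cong (dd⁻¹ zero)) ι.1#-homo)

    row₀ : ∀ j → V zero j ≈ ι (d⁻¹ zero ℚ.* A zero j)
    row₀ j = begin
      V zero j                                    ≈⟨ *-identityˡ _ ⟨
      1# * V zero j                               ≈⟨ *-congʳ cancel ⟨
      d₀ * d₀⁻¹ * V zero j                        ≈⟨ solve 3 (λ d e v → d :* e :* v := e :* (con 1 :* d :* v :+ con 0)) refl d₀ d₀⁻¹ (V zero j) ⟩
      d₀⁻¹ * (1# * d₀ * V zero j + 0#)            ≈⟨ *-congˡ (+-cong (*-congʳ (*-congʳ (L-diag zero))) (sum-zero {t = λ l → L zero (suc l) * ι (d (suc l)) * V (suc l) j} λ l → zero-* (zero-* (L-above (s≤s z≤n))))) ⟨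
      d₀⁻¹ * ∑[ l < suc n ] (L zero l * ι (d l) * V l j) ≈⟨ *-congˡ (product zero j) ⟨
      d₀⁻¹ * ι (A zero j)                         ≈⟨ ι.*-homo _ _ ⟨
      ι (d⁻¹ zero ℚ.* A zero j)                   ∎

    column₀ : ∀ i → L i zero ≈ ι (A i zero ℚ.* d⁻¹ zero)
    column₀ i = begin
      L i zero                                    ≈⟨ *-identityʳ _ ⟨
      L i zero * 1#                               ≈⟨ *-congˡ cancel ⟨
      L i zero * (d₀ * d₀⁻¹)                      ≈⟨ solve 3 (λ d e v → v :* (d :* e) := (v :* d :* con 1 :+ con 0) :* e) refl d₀ d₀⁻¹ (L i zero) ⟩
      (L i zero * d₀ * 1# + 0#) * d₀⁻¹            ≈⟨ *-congʳ (+-cong (*-congˡ (V-diag zero)) (sum-zero {t = λ l → L i (suc l) * ι (d (suc l)) * V (suc l) zero} λ l → *-zero (V-below (s≤s z≤n)))) ⟨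
      (∑[ l < suc n ] (L i l * ι (d l) * V l zero)) * d₀⁻¹ ≈⟨ *-congʳ (product i zero) ⟨
      ι (A i zero) * d₀⁻¹                         ≈⟨ ι.*-homo _ _ ⟨
      ι (A i zero ℚ.* d⁻¹ zero)                   ∎

    tail : Factorisation (d ∘ suc) (schur (d⁻¹ zero) A) (λ i j → L (suc i) (suc j)) (λ i j → V (suc i) (suc j))
    tail = record
      { L-diag  = L-diag ∘ suc
      ; L-above = λ p → L-above (s≤s p)
      ; V-diag  = V-diag ∘ suc
      ; V-below = λ p → V-below (s≤s p)
      ; product = λ i j → let
          a = ι (A (suc i) (suc j))
          q = A (suc i) zero ℚ.* d⁻¹ zero ℚ.* A zero (suc j)
          s = ∑[ l < n ] (L (suc i) (suc l) * ι (d (suc l)) * V (suc l) (suc j))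
          t = L (suc i) zero * d₀ * V zero (suc j)
          t≈q : t ≈ ι q
          t≈q = begin
            L (suc i) zero * d₀ * V zero (suc j)
              ≈⟨ *-cong (*-congʳ (trans (column₀ (suc i)) (ι.*-homo _ _))) (trans (row₀ (suc j)) (ι.*-homo _ _)) ⟩
            ι (A (suc i) zero) * d₀⁻¹ * d₀ * (d₀⁻¹ * ι (A zero (suc j)))
              ≈⟨ solve 4 (λ x e d y → x :* e :* d :* (e :* y) := d :* e :* (x :* e :* y)) refl (ι (A (suc i) zero)) d₀⁻¹ d₀ (ι (A zero (suc j))) ⟩
            d₀ * d₀⁻¹ * (ι (A (suc i) zero) * d₀⁻¹ * ι (A zero (suc j)))
              ≈⟨ trans (*-congʳ cancel) (*-identityˡ _) ⟩
            ι (A (suc i) zero) * d₀⁻¹ * ι (A zero (suc j))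
              ≈⟨ trans (ι.*-homo _ _) (*-congʳ (ι.*-homo _ _)) ⟨
            ι q ∎
        in begin
          ι (A (suc i) (suc j) ℚ.- q)  ≈⟨ trans (ι.+-homo _ _) (+-congˡ (ι.-‿homo q)) ⟩
          a + - ι q                    ≈⟨ +-cong (product (suc i) (suc j)) (-‿cong (sym t≈q)) ⟩
          t + s + - t                  ≈⟨ trans (+-congʳ (+-comm t s)) (+-assoc s t (- t)) ⟩
          s + (t + - t)                ≈⟨ trans (+-congˡ (-‿inverseʳ t)) (+-identityʳ s) ⟩
          s                            ∎
      }

  lower-unique : ∀ {n} {d d⁻¹ : Vector ℚ n} → (∀ l → d l ℚ.* d⁻¹ l ≡ 1ℚ) → ∀ {A L V} →
    Factorisation d A L V → ∀ i j → L i j ≈ ι (lowerFactor d⁻¹ A i j)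
  lower-unique {suc n} p F zero    zero    = trans (Factorisation.L-diag F zero) (sym ι.1#-homo)
  lower-unique {suc n} p F zero    (suc j) = trans (Factorisation.L-above F (s≤s z≤n)) (sym ι.0#-homo)
  lower-unique {suc n} p F (suc i) zero    = Step.column₀ p F (suc i)
  lower-unique {suc n} p F (suc i) (suc j) = lower-unique (p ∘ suc) (Step.tail p F) i j

  upper-unique : ∀ {n} {d d⁻¹ : Vector ℚ n} → (∀ l → d l ℚ.* d⁻¹ l ≡ 1ℚ) → ∀ {A L V} →
    Factorisation d A L V → ∀ i j → V i j ≈ ι (upperFactor d⁻¹ A i j)
  upper-unique {suc n} p F zero    j       = Step.row₀ p F j
  upper-unique {suc n} p F (suc i) zero    = trans (Factorisation.V-below F (s≤s z≤n)) (sym ι.0#-homo)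
  upper-unique {suc n} p F (suc i) (suc j) = upper-unique (p ∘ suc) (Step.tail p F) i j

module fromℤᴹ = Homomorphism ℤ-ring ℚ-ring fromℤ fromℤ-isRingHomomorphism

-- Translating a rational by an integer into the interval [-1, 1].
round : ∀ q → ∃[ z ] ∣ q ℚ.+ fromℤ z ∣ ℚ.≤ 1ℚ
round q@(mkℚ n d-1 _) = z , ℚ.toℚᵘ-cancel-≤ (ℚᵘ.≤-respˡ-≃ (ℚᵘ.≃-sym eq) (ℚᵘ.*≤* bound))
  where
  d = suc d-1
  z = ℤ.- (n ℤ./ℕ d)
  r = n ℤ.%ℕ d
  num : n ℤ.* 1ℤ ℤ.+ z ℤ.* + d ≡ + r
  num = begin
    n ℤ.* 1ℤ ℤ.+ z ℤ.* + d                                 ≡⟨ ≡.cong₂ ℤ._+_ (ℤ.*-identityʳ n) (≡.sym (ℤ.neg-distribˡ-* (n ℤ./ℕ d) (+ d))) ⟩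
    n ℤ.- n ℤ./ℕ d ℤ.* + d                                 ≡⟨ ≡.cong (ℤ._- n ℤ./ℕ d ℤ.* + d) (ℤ.a≡a%ℕn+[a/ℕn]*n n d) ⟩
    + r ℤ.+ n ℤ./ℕ d ℤ.* + d ℤ.- n ℤ./ℕ d ℤ.* + d          ≡⟨ ℤ.+-assoc (+ r) (n ℤ./ℕ d ℤ.* + d) _ ⟩
    + r ℤ.+ (n ℤ./ℕ d ℤ.* + d ℤ.- n ℤ./ℕ d ℤ.* + d)        ≡⟨ ≡.cong (λ x → + r ℤ.+ x) (ℤ.+-inverseʳ (n ℤ./ℕ d ℤ.* + d)) ⟩
    + r ℤ.+ 0ℤ                                             ≡⟨ ℤ.+-identityʳ (+ r) ⟩
    + r                                                    ∎
    where open ≡.≡-Reasoning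
  eq : ℚ.toℚᵘ ∣ q ℚ.+ fromℤ z ∣ ℚᵘ.≃ ℚᵘ.∣ ℚᵘ.mkℚᵘ n d-1 ℚᵘ.+ ℚᵘ.mkℚᵘ z 0 ∣
  eq = ℚᵘ.≃-trans (ℚ.toℚᵘ-homo-∣-∣ (q ℚ.+ fromℤ z))
    (ℚᵘ.∣-∣-cong (ℚᵘ.≃-trans (ℚ.toℚᵘ-homo-+ q (fromℤ z)) (ℚᵘ.+-congʳ (ℚᵘ.mkℚᵘ n d-1) (toℚᵘ-fromℤ z))))
  bound : + ℤ.∣ n ℤ.* 1ℤ ℤ.+ z ℤ.* + d ∣ ℤ.* 1ℤ ℤ.≤ 1ℤ ℤ.* + (d ℕ.* 1)
  bound = begin
    + ℤ.∣ n ℤ.* 1ℤ ℤ.+ z ℤ.* + d ∣ ℤ.* 1ℤ   ≡⟨ ℤ.*-identityʳ _ ⟩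
    + ℤ.∣ n ℤ.* 1ℤ ℤ.+ z ℤ.* + d ∣          ≡⟨ ≡.cong (λ x → + ℤ.∣ x ∣) num ⟩
    + r                                     ≤⟨ ℤ.+≤+ (ℕ.<⇒≤ (ℤ.n%ℕd<d n d)) ⟩
    + d                                     ≡⟨ ≡.cong +_ (ℕ.*-identityʳ d) ⟨
    + (d ℕ.* 1)                             ≡⟨ ℤ.*-identityˡ _ ⟨
    1ℤ ℤ.* + (d ℕ.* 1)                      ∎
    where open ℤ.≤-Reasoning

Small : ∀ {m n} → Matℚ m n → Set
Small A = ∀ i j → ∣ A i j ∣ ℚ.≤ 1ℚ

module _ where
  open ℚᴹ

  reduce-row : ∀ {n} {B : Matℚ n n} → Unipotent B → (r : Vector ℚ n) →
    Σ[ s ∈ Vector ℤ n ] (∀ j → ∣ r j ℚ.+ (∑[ k < n ] (fromℤ (s k) ℚ.* B k j)) ∣ ℚ.≤ 1ℚ)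
  reduce-row {zero} u r = [] , λ ()
  reduce-row {suc n} {B} u r = s₀ ∷ s , bound
    where
    s₀ = proj₁ (round (r zero))
    r′ : Vector ℚ n
    r′ j = r (suc j) ℚ.+ fromℤ s₀ ℚ.* B zero (suc j)
    IH = reduce-row (unipotent-tail u) r′
    s = proj₁ IH
    bound : ∀ j → ∣ r j ℚ.+ (fromℤ s₀ ℚ.* B zero j ℚ.+ (∑[ k < n ] (fromℤ (s k) ℚ.* B (suc k) j))) ∣ ℚ.≤ 1ℚ
    bound zero = ≡.subst (λ x → ∣ r zero ℚ.+ x ∣ ℚ.≤ 1ℚ) (≡.sym lem) (proj₂ (round (r zero)))
      where
      lem : fromℤ s₀ ℚ.* B zero zero ℚ.+ (∑[ k < n ] (fromℤ (s k) ℚ.* B (suc k) zero)) ≡ fromℤ s₀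
      lem = ≡.trans (≡.cong₂ ℚ._+_
        (≡.trans (≡.cong (fromℤ s₀ ℚ.*_) (u .diag zero)) (ℚ.*-identityʳ (fromℤ s₀)))
        (sum-zero {t = λ k → fromℤ (s k) ℚ.* B (suc k) zero} λ k → *-zero {x = fromℤ (s k)} (u .below {suc k} {zero} (s≤s z≤n))))
        (ℚ.+-identityʳ (fromℤ s₀))
    bound (suc j) = ≡.subst (λ x → ∣ x ∣ ℚ.≤ 1ℚ) (ℚ.+-assoc (r (suc j)) _ _) (proj₂ IH j)

  reduceˡ : ∀ {n} {B : Matℚ n n} → Unipotent B →
    Σ[ u ∈ Matℤ n n ] Unipotentℤ u × Small (fromℤᴹ.image u · B)
  reduceˡ {zero} u = (λ ()) , record { diag = λ () ; below = λ { {()} } } , λ ()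
  reduceˡ {suc n} {B} u = v , v-unipotent , small
    where
    IH = reduceˡ (unipotent-tail u)
    row = reduce-row (unipotent-tail u) (λ j → B zero (suc j))
    v : Matℤ (suc n) (suc n)
    v zero    zero    = 1ℤ
    v zero    (suc j) = proj₁ row j
    v (suc i) zero    = 0ℤ
    v (suc i) (suc j) = proj₁ IH i j
    v-unipotent : Unipotentℤ v
    v-unipotent .ℤᴹ.diag zero = ≡.refl
    v-unipotent .ℤᴹ.diag (suc i) = proj₁ (proj₂ IH) .ℤᴹ.diag i
    v-unipotent .ℤᴹ.below {suc i} {zero} _ = ≡.refl
    v-unipotent .ℤᴹ.below {suc i} {suc j} (s≤s p) = proj₁ (proj₂ IH) .ℤᴹ.below p
    unip = ·-unipotent (fromℤᴹ.image-unipotent v-unipotent) u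
    small : Small (fromℤᴹ.image v · B)
    small zero zero = ℚ.≤-reflexive (≡.cong ∣_∣ (unip .diag zero))
    small zero (suc j) = ≡.subst (λ x → ∣ x ℚ.+ (∑[ k < n ] (fromℤ (proj₁ row k) ℚ.* B (suc k) (suc j))) ∣ ℚ.≤ 1ℚ) (≡.sym (ℚ.*-identityˡ (B zero (suc j)))) (proj₂ row j)
    small (suc i) zero = ≡.subst (λ x → ∣ x ∣ ℚ.≤ 1ℚ) (≡.sym (unip .below {suc i} {zero} (s≤s z≤n))) (ℚ.nonNegative⁻¹ 1ℚ)
    small (suc i) (suc j) = ≡.subst (λ x → ∣ x ∣ ℚ.≤ 1ℚ)
      (≡.sym (≡.trans (≡.cong (ℚ._+ rest) (ℚ.*-zeroˡ (B zero (suc j)))) (ℚ.+-identityˡ rest)))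
      (proj₂ (proj₂ IH) i j)
      where rest = (fromℤᴹ.image (proj₁ IH) · (λ i j → B (suc i) (suc j))) i j

  reduceʳ : ∀ {n} {B : Matℚ n n} → Unipotent B →
    Σ[ v ∈ Matℤ n n ] Unipotentℤ v × Small (B · fromℤᴹ.image v)
  reduceʳ {zero} u = (λ ()) , record { diag = λ () ; below = λ { {()} } } , λ ()
  reduceʳ {suc n} {B} u = v , v-unipotent , small
    where
    IH = reduceʳ (unipotent-tail u)
    r : Vector ℚ n
    r j = ∑[ k < n ] (B zero (suc k) ℚ.* fromℤ (proj₁ IH k j))
    v : Matℤ (suc n) (suc n)
    v zero    zero    = 1ℤ
    v zero    (suc j) = proj₁ (round (r j))
    v (suc i) zero    = 0ℤ
    v (suc i) (suc j) = proj₁ IH i j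
    v-unipotent : Unipotentℤ v
    v-unipotent .ℤᴹ.diag zero = ≡.refl
    v-unipotent .ℤᴹ.diag (suc i) = proj₁ (proj₂ IH) .ℤᴹ.diag i
    v-unipotent .ℤᴹ.below {suc i} {zero} _ = ≡.refl
    v-unipotent .ℤᴹ.below {suc i} {suc j} (s≤s p) = proj₁ (proj₂ IH) .ℤᴹ.below p
    unip = ·-unipotent u (fromℤᴹ.image-unipotent v-unipotent)
    small : Small (B · fromℤᴹ.image v)
    small zero zero = ℚ.≤-reflexive (≡.cong ∣_∣ (unip .diag zero))
    small zero (suc j) = ≡.subst (λ x → ∣ x ∣ ℚ.≤ 1ℚ)
      (≡.trans (ℚ.+-comm (r j) z) (≡.cong (ℚ._+ r j) (≡.sym (≡.trans (≡.cong (ℚ._* z) (u .diag zero)) (ℚ.*-identityˡ z)))))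
      (proj₂ (round (r j)))
      where z = fromℤ (proj₁ (round (r j)))
    small (suc i) zero = ≡.subst (λ x → ∣ x ∣ ℚ.≤ 1ℚ) (≡.sym (unip .below {suc i} {zero} (s≤s z≤n))) (ℚ.nonNegative⁻¹ 1ℚ)
    small (suc i) (suc j) = ≡.subst (λ x → ∣ x ∣ ℚ.≤ 1ℚ)
      (≡.sym (≡.trans (≡.cong (ℚ._+ rest) (zero-* (u .below {suc i} {zero} (s≤s z≤n)))) (ℚ.+-identityˡ rest)))
      (proj₂ (proj₂ IH) i j)
      where rest = ((λ i j → B (suc i) (suc j)) · fromℤᴹ.image (proj₁ IH)) i j

  ∣sum∣≤ : ∀ {n} {s t : Vector ℚ n} → (∀ i → ∣ s i ∣ ℚ.≤ t i) → ∣ sum s ∣ ℚ.≤ sum t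
  ∣sum∣≤ {zero} p = ℚ.≤-refl
  ∣sum∣≤ {suc n} {s} p = ℚ.≤-trans (ℚ.∣p+q∣≤∣p∣+∣q∣ (s zero) _) (ℚ.+-mono-≤ (p zero) (∣sum∣≤ (p ∘ suc)))

∣xyz∣≤∣y∣ : ∀ {x y z} → ∣ x ∣ ℚ.≤ 1ℚ → ∣ z ∣ ℚ.≤ 1ℚ → ∣ x ℚ.* y ℚ.* z ∣ ℚ.≤ ∣ y ∣
∣xyz∣≤∣y∣ {x} {y} {z} p q = begin
  ∣ x ℚ.* y ℚ.* z ∣           ≡⟨ ≡.trans (ℚ.∣p*q∣≡∣p∣*∣q∣ (x ℚ.* y) z) (≡.cong (ℚ._* ∣ z ∣) (ℚ.∣p*q∣≡∣p∣*∣q∣ x y)) ⟩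
  ∣ x ∣ ℚ.* ∣ y ∣ ℚ.* ∣ z ∣   ≤⟨ ℚ.*-monoʳ-≤-nonNeg ∣ z ∣ {{ℚ.∣-∣-nonNeg z}} (ℚ.*-monoʳ-≤-nonNeg ∣ y ∣ {{ℚ.∣-∣-nonNeg y}} p) ⟩
  1ℚ ℚ.* ∣ y ∣ ℚ.* ∣ z ∣      ≡⟨ ≡.cong (ℚ._* ∣ z ∣) (ℚ.*-identityˡ ∣ y ∣) ⟩
  ∣ y ∣ ℚ.* ∣ z ∣             ≤⟨ ℚ.*-monoˡ-≤-nonNeg ∣ y ∣ {{ℚ.∣-∣-nonNeg y}} q ⟩
  ∣ y ∣ ℚ.* 1ℚ                ≡⟨ ℚ.*-identityʳ ∣ y ∣ ⟩
  ∣ y ∣                       ∎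
  where open ℚ.≤-Reasoning

-- The integers of absolute value at most K (0 twice).
integers : ℕ → List ℤ
integers K = List.map +_ (List.upTo (suc K)) List.++ List.map (λ k → ℤ.- + k) (List.upTo (suc K))

integers-complete : ∀ {K} z → ℤ.∣ z ∣ ℕ.≤ K → z ∈ integers K
integers-complete {K} (+ k) p = Any.++⁺ˡ (Any.map⁺ (Any.map (≡.cong +_) (∈-upTo⁺ (s≤s p))))
integers-complete {K} ℤ.-[1+ k ] p = Any.++⁺ʳ (List.map +_ (List.upTo (suc K))) (Any.map⁺ (Any.map (≡.cong (λ k → ℤ.- + k)) (∈-upTo⁺ (s≤s p))))

∣fromℤ∣≤⇒ : ∀ z q → ∣ fromℤ z ∣ ℚ.≤ q → ℤ.∣ z ∣ ℕ.≤ ℤ.∣ ↥ q ∣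
∣fromℤ∣≤⇒ z q@(mkℚ n d-1 _) p with ℚᵘ.≤-respˡ-≃ (ℚᵘ.≃-trans (ℚ.toℚᵘ-homo-∣-∣ (fromℤ z)) (ℚᵘ.∣-∣-cong (toℚᵘ-fromℤ z))) (ℚ.toℚᵘ-mono-≤ p)
... | ℚᵘ.*≤* r = ℤ.drop‿+≤+ (begin
  + ℤ.∣ z ∣                 ≤⟨ ℤ.+≤+ (ℕ.m≤m*n ℤ.∣ z ∣ (suc d-1)) ⟩
  + (ℤ.∣ z ∣ ℕ.* suc d-1)   ≡⟨ ℤ.pos-* ℤ.∣ z ∣ (suc d-1) ⟩
  + ℤ.∣ z ∣ ℤ.* + suc d-1   ≤⟨ r ⟩
  n ℤ.* 1ℤ                  ≡⟨ ℤ.*-identityʳ n ⟩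
  n                         ≤⟨ i≤∣i∣ n ⟩
  + ℤ.∣ n ∣                 ∎)
  where
  open ℤ.≤-Reasoning
  i≤∣i∣ : ∀ i → i ℤ.≤ + ℤ.∣ i ∣
  i≤∣i∣ (+ _) = ℤ.≤-refl
  i≤∣i∣ ℤ.-[1+ _ ] = ℤ.-≤+

vectors : ∀ {a} {X : Set a} → List X → ∀ n → List (Vector X n)
vectors xs zero = List.[ [] ]
vectors xs (suc n) = List.cartesianProductWith _∷_ xs (vectors xs n)

vectors-complete : ∀ {a b ℓ} {X : Set a} {Y : Set b} (_~_ : X → Y → Set ℓ) {ys : List Y} →
  ∀ {n} (f : Vector X n) → (∀ i → Any (f i ~_) ys) → Any (λ g → ∀ i → f i ~ g i) (vectors ys n)
vectors-complete _~_ {n = zero} f p = here λ ()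
vectors-complete _~_ {n = suc n} f p = Any.cartesianProductWith⁺ _∷_
  (λ { q r zero → q ; q r (suc i) → r i }) (p zero) (vectors-complete _~_ (f ∘ suc) (p ∘ suc))

-- The library has neither ℝ nor ℂ.  This structure keeps what the definition
-- of the Kloosterman sum uses of them: ℝ is a commutative ring containing ℚ,
-- and e is a homomorphism from (ℝ, +) to (ℂ, ·) that is trivial on the
-- integers.  The real numbers, the complex numbers and e(z) = exp(2πiz) form
-- such a structure; everything below is stated for all of them.
record Exponential a ℓ₁ b ℓ₂ : Set (lsuc (a ⊔ ℓ₁ ⊔ b ⊔ ℓ₂)) where
  field
    ℝ : CommutativeRing a ℓ₁
    ℂ : CommutativeRing b ℓ₂

  module ℝ = CommutativeRing ℝ
  module ℂ = CommutativeRing ℂ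

  open RingMorphisms (CommutativeRing.rawRing ℚ-ring) ℝ.rawRing using (IsRingMonomorphism)
  open MonoidMorphisms (CommutativeRing.+-rawMonoid ℝ) (CommutativeRing.*-rawMonoid ℂ) using (IsMonoidHomomorphism)

  field
    ι : ℚ → ℝ.Carrier
    ι-isRingMonomorphism : IsRingMonomorphism ι
    e : ℝ.Carrier → ℂ.Carrier
    e-isMonoidHomomorphism : IsMonoidHomomorphism e
    e[1]≈1 : e ℝ.1# ℂ.≈ ℂ.1#

Finite : ∀ {a ℓ} → Setoid a ℓ → Set (a ⊔ ℓ)
Finite S = ∃[ n ] Bijection (≡.setoid (Fin n)) S

∑ : ∀ {a ℓ c ℓ′} {S : Setoid a ℓ} (R : CommutativeRing c ℓ′) → Finite S →
  Func S (CommutativeRing.setoid R) → CommutativeRing.Carrier R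
∑ R (n , enum) f = Matrices.sum R (λ i → Func.to f (Bijection.to enum i))

module _ {a ℓ} {S : Setoid a ℓ} where

  open Setoid S

  private
    all-lookup : ∀ {p} {P : Carrier → Set p} {xs} → All P xs → ∀ i → P (List.lookup xs i)
    all-lookup (p All.∷ _)  zero    = p
    all-lookup (_ All.∷ ps) (suc i) = all-lookup ps i

    lookup-injective : ∀ {xs} → AllPairs (λ x y → ¬ x ≈ y) xs → ∀ i j → List.lookup xs i ≈ List.lookup xs j → i ≡ j
    lookup-injective (_ AllPairs.∷ _)  zero    zero    _  = ≡.refl
    lookup-injective (p AllPairs.∷ _)  zero    (suc j) eq = ⊥-elim (all-lookup p j eq)
    lookup-injective (p AllPairs.∷ _)  (suc i) zero    eq = ⊥-elim (all-lookup p i (sym eq))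
    lookup-injective (_ AllPairs.∷ ps) (suc i) (suc j) eq = ≡.cong suc (lookup-injective ps i j eq)

  enumerate : (∀ x y → Dec (x ≈ y)) → (xs : List Carrier) → (∀ x → Any (x ≈_) xs) → Finite S
  enumerate _≟_ xs complete = List.length ys , record
    { to = List.lookup ys
    ; cong = λ { ≡.refl → refl }
    ; bijective = (λ {i} {j} → lookup-injective (deduplicate-! DS xs) i j) , λ x →
        Any.index (ys-complete x) , λ { ≡.refl → sym (Any.lookup-index (ys-complete x)) }
    }
    where
    DS : DecSetoid _ _
    DS = record { isDecEquivalence = record { isEquivalence = isEquivalence ; _≟_ = _≟_ } }
    ys : List Carrier
    ys = List.deduplicate _≟_ xs
    ys-complete : ∀ x → Any (x ≈_) ys
    ys-complete x = Membership.∈-deduplicate⁺ S _≟_ (λ p q → trans q (sym p)) (complete x)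

-- Indices start at 0: the entry in row n - 1 - j and column j is (-1)ʲ.
w₀ : ∀ {n} → Matℤ n n
w₀ i j with i Fin.≟ opposite j
... | yes _ = ℤᴹ.sign j
... | no  _ = 0ℤ

module Torus {r : ℕ} (D : Vector ℕ r) (D>0 : ∀ i → NonZero (D i)) where

  -- (D₀, D₁, …, Dₙ₋₁, Dₙ) for n = r + 1, with the convention D₀ = Dₙ = 1.
  D̂ : Vector ℕ (suc (suc r))
  D̂ = 1 ∷ insertAt D (fromℕ r) 1

  private
    insertAt-nonZero : ∀ {n} (E : Vector ℕ n) → (∀ i → NonZero (E i)) → ∀ k i → NonZero (insertAt E k 1 i)
    insertAt-nonZero E p zero zero = _
    insertAt-nonZero E p zero (suc i) = p i
    insertAt-nonZero {suc n} E p (suc k) zero = p zero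
    insertAt-nonZero {suc n} E p (suc k) (suc i) = insertAt-nonZero (E ∘ suc) (p ∘ suc) k i

  D̂>0 : ∀ i → NonZero (D̂ i)
  D̂>0 zero = _
  D̂>0 (suc i) = insertAt-nonZero D D>0 (fromℕ r) i

  -- With 1-based i, the i-th diagonal entry is Dₙ₋ᵢ₊₁ / Dₙ₋ᵢ.
  c : Vector ℚ (suc r)
  c i = _/_ (+ D̂ (opposite (inject₁ i))) (D̂ (opposite (suc i))) {{D̂>0 (opposite (suc i))}}

  cw₀ : Matℚ (suc r) (suc r)
  cw₀ = ℚᴹ.diagonal c ℚᴹ.· fromℤᴹ.image w₀

  c⁻¹ : Vector ℚ (suc r)
  c⁻¹ i = _/_ (+ D̂ (opposite (suc i))) (D̂ (opposite (inject₁ i))) {{D̂>0 (opposite (inject₁ i))}}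

  private
    /-inverse : ∀ m n {{p : NonZero m}} {{q : NonZero n}} → (+ m) / n ℚ.* ((+ n) / m) ≡ 1ℚ
    /-inverse (suc m) (suc n) = ℚ.toℚᵘ-injective (ℚᵘ.≃-trans (ℚ.toℚᵘ-homo-* ((+ suc m) / suc n) ((+ suc n) / suc m))
      (ℚᵘ.≃-trans (ℚᵘ.*-cong (ℚ.toℚᵘ-fromℚᵘ (ℚᵘ.mkℚᵘ (+ suc m) n)) (ℚ.toℚᵘ-fromℚᵘ (ℚᵘ.mkℚᵘ (+ suc n) m)))
      (ℚᵘ.*≡* (≡.trans (ℤ.*-identityʳ _) (≡.trans (ℤ.*-comm (+ suc m) (+ suc n)) (≡.sym (ℤ.*-identityˡ _)))))))

    sign² : ∀ n → ((ℤ.- 1ℤ) ℤᴹ.^ n) ℤ.* ((ℤ.- 1ℤ) ℤᴹ.^ n) ≡ 1ℤ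
    sign² zero = ≡.refl
    sign² (suc n) = ≡.trans (≡.cong₂ ℤ._*_ (ℤ.-1*i≡-i s) (ℤ.-1*i≡-i s))
      (≡.trans (≡.sym (ℤ.neg-distribˡ-* s (ℤ.- s))) (≡.trans (≡.cong ℤ.-_ (≡.sym (ℤ.neg-distribʳ-* s s)))
      (≡.trans (ℤ.neg-involutive (s ℤ.* s)) (sign² n))))
      where s = (ℤ.- 1ℤ) ℤᴹ.^ n

  pivot pivot⁻¹ : Vector ℚ (suc r)
  pivot l = c (opposite l) ℚ.* fromℤ (ℤᴹ.sign l)
  pivot⁻¹ l = c⁻¹ (opposite l) ℚ.* fromℤ (ℤᴹ.sign l)

  pivot-inverse : ∀ l → pivot l ℚ.* pivot⁻¹ l ≡ 1ℚ
  pivot-inverse l = begin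
    c l′ ℚ.* s ℚ.* (c⁻¹ l′ ℚ.* s)     ≡⟨ ℚ.*-assoc (c l′) s _ ⟩
    c l′ ℚ.* (s ℚ.* (c⁻¹ l′ ℚ.* s))   ≡⟨ ≡.cong (c l′ ℚ.*_) (≡.trans (≡.cong (s ℚ.*_) (ℚ.*-comm (c⁻¹ l′) s)) (≡.sym (ℚ.*-assoc s s _))) ⟩
    c l′ ℚ.* (s ℚ.* s ℚ.* c⁻¹ l′)     ≡⟨ ≡.cong (λ x → c l′ ℚ.* (x ℚ.* c⁻¹ l′)) ss ⟩
    c l′ ℚ.* (1ℚ ℚ.* c⁻¹ l′)          ≡⟨ ≡.cong (c l′ ℚ.*_) (ℚ.*-identityˡ (c⁻¹ l′)) ⟩
    c l′ ℚ.* c⁻¹ l′                   ≡⟨ /-inverse _ _ {{D̂>0 (opposite (inject₁ l′))}} {{D̂>0 (opposite (suc l′))}} ⟩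
    1ℚ                                ∎
    where
    open ≡.≡-Reasoning
    l′ = opposite l
    s = fromℤ (ℤᴹ.sign l)
    ss : s ℚ.* s ≡ 1ℚ
    ss = ≡.trans (≡.sym (RingMorphisms.IsRingHomomorphism.*-homo fromℤ-isRingHomomorphism (ℤᴹ.sign l) (ℤᴹ.sign l)))
      (≡.cong fromℤ (sign² (toℕ l)))

  private
    w₀-on : ∀ {n} (l : Fin n) → w₀ (opposite l) l ≡ ℤᴹ.sign l
    w₀-on l with opposite l Fin.≟ opposite l
    ... | yes _ = ≡.refl
    ... | no ¬p = ⊥-elim (¬p ≡.refl)

    w₀-off : ∀ {n} {k l : Fin n} → k ≢ opposite l → w₀ k l ≡ 0ℤ
    w₀-off {k = k} {l} k≢ with k Fin.≟ opposite l
    ... | yes p = ⊥-elim (k≢ p)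
    ... | no _ = ≡.refl

  cw₀-on : ∀ l → cw₀ (opposite l) l ≡ pivot l
  cw₀-on l = ≡.trans (ℚᴹ.·-diagonalˡ c (fromℤᴹ.image w₀) (opposite l) l) (≡.cong (λ x → c (opposite l) ℚ.* fromℤ x) (w₀-on l))

  cw₀-off : ∀ {k l} → k ≢ opposite l → cw₀ k l ≡ 0ℚ
  cw₀-off {k} {l} p = ≡.trans (ℚᴹ.·-diagonalˡ c (fromℤᴹ.image w₀) k l)
    (≡.trans (≡.cong (λ x → c k ℚ.* fromℤ x) (w₀-off p)) (ℚ.*-zeroʳ (c k)))

  -- The only possible unipotent factors of an integral matrix B in the big
  -- cell: reversing the rows turns B = b₁·cw₀·b₂ into an LDU factorisation with
  -- pivots independent of B.
  left right : Matℤ (suc r) (suc r) → Matℚ (suc r) (suc r)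
  left  B i j = lowerFactor pivot⁻¹ (λ i j → fromℤ (B (opposite i) j)) (opposite i) (opposite j)
  right B = upperFactor pivot⁻¹ (λ i j → fromℤ (B (opposite i) j))

  module Bruhat {a ℓ} (S : CommutativeRing a ℓ) (φ : ℚ → CommutativeRing.Carrier S) (φ-hom : IsHomomorphism ℚ-ring S φ) where

    open Matrices S
    open Elimination S φ φ-hom
    private
      module φ = RingMorphisms.IsRingHomomorphism φ-hom
      module φᴹ = Homomorphism ℚ-ring S φ φ-hom

    Decomposes : Matℤ (suc r) (suc r) → Mat (suc r) (suc r) → Mat (suc r) (suc r) → Set ℓ
    Decomposes B b₁ b₂ = φᴹ.image (fromℤᴹ.image B) ≋ b₁ · φᴹ.image cw₀ · b₂

    expand : ∀ (b₁ b₂ : Mat (suc r) (suc r)) i j →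
      (b₁ · φᴹ.image cw₀ · b₂) i j ≈ ∑[ l < suc r ] (b₁ i (opposite l) * φ (pivot l) * b₂ l j)
    expand b₁ b₂ i j = sum-cong-≋ λ l → *-congʳ {b₂ l j} (trans
      (sum-single {t = λ k → b₁ i k * φ (cw₀ k l)} (opposite l) λ k k≢ → *-zero (trans (φ.⟦⟧-cong (cw₀-off {k} {l} k≢)) φ.0#-homo))
      (*-congˡ {b₁ i (opposite l)} (φ.⟦⟧-cong (cw₀-on l))))

    private
      opposite-< : ∀ {n} {i j : Fin n} → i Fin.< j → opposite j Fin.< opposite i
      opposite-< {n} {i} {j} i<j = ≡.subst₂ ℕ._<_ (≡.sym (Fin.opposite-prop j)) (≡.sym (Fin.opposite-prop i))
        (ℕ.∸-monoʳ-< (s≤s i<j) (Fin.toℕ<n j))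

    factorisation : ∀ B {b₁ b₂} → Unipotent b₁ → Unipotent b₂ → Decomposes B b₁ b₂ →
      Factorisation pivot (λ i j → fromℤ (B (opposite i) j)) (λ i l → b₁ (opposite i) (opposite l)) b₂
    factorisation B {b₁} {b₂} u₁ u₂ p = record
      { L-diag  = λ i → u₁ .diag (opposite i)
      ; L-above = λ i<j → u₁ .below (opposite-< i<j)
      ; V-diag  = u₂ .diag
      ; V-below = u₂ .below
      ; product = λ i j → trans (p .at (opposite i) j) (expand b₁ b₂ (opposite i) j)
      }

    left-unique : ∀ B {b₁ b₂} → Unipotent b₁ → Unipotent b₂ → Decomposes B b₁ b₂ → b₁ ≋ φᴹ.image (left B)
    left-unique B {b₁} u₁ u₂ p .at i j = trans
      (reflexive (≡.sym (≡.cong₂ b₁ (Fin.opposite-involutive i) (Fin.opposite-involutive j))))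
      (lower-unique pivot-inverse (factorisation B u₁ u₂ p) (opposite i) (opposite j))

    right-unique : ∀ B {b₁ b₂} → Unipotent b₁ → Unipotent b₂ → Decomposes B b₁ b₂ → b₂ ≋ φᴹ.image (right B)
    right-unique B u₁ u₂ p = entrywise (upper-unique pivot-inverse (factorisation B u₁ u₂ p))

  module ℚ-Bruhat = Bruhat ℚ-ring id (isRingHomomorphism (CommutativeRing.rawRing ℚ-ring) ≡.refl)

module Kloosterman {a ℓ₁ b ℓ₂} (𝓔 : Exponential a ℓ₁ b ℓ₂) where

  open Exponential 𝓔
  open ℂ using () renaming (_≈_ to _≈ℂ_) public

  module ℝᴹ = Matrices ℝ
  module ι-mono = RingMorphisms.IsRingMonomorphism ι-isRingMonomorphism
  module ιᴹ = Homomorphism ℚ-ring ℝ ι ι-mono.isRingHomomorphism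
  open ℝᴹ using () renaming (Mat to Matℝ; Unipotent to Unipotentℝ)

  ιℤ : ℤ → ℝ.Carrier
  ιℤ z = ι (fromℤ z)

  ψ : ∀ {r} → Vector ℤ r → Matℝ (suc r) (suc r) → ℂ.Carrier
  ψ {r} N u = e (ℝᴹ.sum λ (i : Fin r) → ιℤ (N i) ℝ.* u (inject₁ i) (suc i))

  module _ where
    open import Relation.Binary.Reasoning.Setoid ℂ.setoid
    private module e = MonoidMorphisms.IsMonoidHomomorphism e-isMonoidHomomorphism

    e-ℕ : ∀ n → e (ιℤ (+ n)) ℂ.≈ ℂ.1#
    e-ℕ zero = ℂ.trans (e.⟦⟧-cong ι-mono.0#-homo) e.ε-homo
    e-ℕ (suc n) = begin
      e (ιℤ (+ suc n))               ≈⟨ e.⟦⟧-cong (ℝ.trans (ι-mono.⟦⟧-cong (RingMorphisms.IsRingHomomorphism.+-homo fromℤ-isRingHomomorphism 1ℤ (+ n))) (ℝ.trans (ι-mono.+-homo _ _) (ℝ.+-congʳ ι-mono.1#-homo))) ⟩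
      e (ℝ.1# ℝ.+ ιℤ (+ n))          ≈⟨ e.homo _ _ ⟩
      e ℝ.1# ℂ.* e (ιℤ (+ n))        ≈⟨ ℂ.*-cong e[1]≈1 (e-ℕ n) ⟩
      ℂ.1# ℂ.* ℂ.1#                  ≈⟨ ℂ.*-identityˡ ℂ.1# ⟩
      ℂ.1#                           ∎

    e-ℤ : ∀ z → e (ιℤ z) ℂ.≈ ℂ.1#
    e-ℤ (+ n) = e-ℕ n
    e-ℤ z@(ℤ.-[1+ n ]) = begin
      e (ιℤ z)                             ≈⟨ ℂ.*-identityʳ _ ⟨
      e (ιℤ z) ℂ.* ℂ.1#                    ≈⟨ ℂ.*-congˡ (e-ℕ (suc n)) ⟨
      e (ιℤ z) ℂ.* e (ιℤ (+ suc n))        ≈⟨ e.homo _ _ ⟨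
      e (ιℤ z ℝ.+ ιℤ (+ suc n))            ≈⟨ e.⟦⟧-cong (ℝ.trans (ℝ.sym (ι-mono.+-homo _ _)) (ι-mono.⟦⟧-cong (≡.sym (RingMorphisms.IsRingHomomorphism.+-homo fromℤ-isRingHomomorphism z (+ suc n))))) ⟩
      e (ιℤ (z ℤ.+ + suc n))               ≡⟨ ≡.cong (e ∘ ιℤ) (ℤ.+-inverseˡ (+ suc n)) ⟩
      e (ιℤ 0ℤ)                            ≈⟨ e-ℕ 0 ⟩
      ℂ.1#                                 ∎

    ψ-translate : ∀ {r} (T z : Vector ℤ r) (b b′ : Matℝ (suc r) (suc r)) →
      (∀ i → b′ (inject₁ i) (suc i) ℝ.≈ ιℤ (z i) ℝ.+ b (inject₁ i) (suc i)) → ψ T b ℂ.≈ ψ T b′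
    ψ-translate {r} T z b b′ p = ℂ.sym (begin
      e (ℝᴹ.sum (λ i → ιℤ (T i) ℝ.* b′ (inject₁ i) (suc i)))   ≈⟨ e.⟦⟧-cong (ℝ.trans (ℝᴹ.sum-cong-≋ split) (ℝᴹ.∑-distrib-+ (λ i → ιℤ (T i ℤ.* z i)) t)) ⟩
      e (ℝᴹ.sum (λ i → ιℤ (T i ℤ.* z i)) ℝ.+ ℝᴹ.sum t)         ≈⟨ e.homo _ _ ⟩
      e (ℝᴹ.sum (λ i → ιℤ (T i ℤ.* z i))) ℂ.* ψ T b            ≈⟨ ℂ.*-congʳ (e.⟦⟧-cong (ℝ.trans (ι-mono.⟦⟧-cong (fromℤᴹ.sum-homo (λ i → T i ℤ.* z i))) (ιᴹ.sum-homo (λ i → fromℤ (T i ℤ.* z i))))) ⟨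
      e (ιℤ (ℤᴹ.sum (λ i → T i ℤ.* z i))) ℂ.* ψ T b            ≈⟨ ℂ.*-congʳ (e-ℤ (ℤᴹ.sum (λ i → T i ℤ.* z i))) ⟩
      ℂ.1# ℂ.* ψ T b                                           ≈⟨ ℂ.*-identityˡ _ ⟩
      ψ T b                                                    ∎)
      where
      t : Vector ℝ.Carrier r
      t i = ιℤ (T i) ℝ.* b (inject₁ i) (suc i)
      split : ∀ i → ιℤ (T i) ℝ.* b′ (inject₁ i) (suc i) ℝ.≈ ιℤ (T i ℤ.* z i) ℝ.+ t i
      split i = ℝ.trans (ℝ.*-congˡ (p i)) (ℝ.trans (ℝ.distribˡ _ _ _) (ℝ.+-congʳ (ℝ.sym
        (ℝ.trans (ι-mono.⟦⟧-cong (RingMorphisms.IsRingHomomorphism.*-homo fromℤ-isRingHomomorphism (T i) (z i))) (ι-mono.*-homo _ _)))))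

  module _ {r : ℕ} (D : Vector ℕ r) (D>0 : ∀ i → NonZero (D i)) where
    open Torus D D>0

    -- C(c).  The factors b₁ and b₂ are determined by γ (see b₁-rational and
    -- b₂-rational), so carrying them along adds no elements.
    record Cell : Set (a ⊔ ℓ₁) where
      open ℝᴹ using (_≋_; _·_)
      field
        γ            : Matℤ (suc r) (suc r)
        det-γ        : ℤᴹ.det γ ≡ 1ℤ
        b₁ b₂        : Matℝ (suc r) (suc r)
        b₁-unipotent : Unipotentℝ b₁
        b₂-unipotent : Unipotentℝ b₂
        bruhat       : ιᴹ.image (fromℤᴹ.image γ) ≋ b₁ · ιᴹ.image cw₀ · b₂

    open Cell

    -- Equality in U(ℤ)\C(c)/U(ℤ).
    _~_ : Cell → Cell → Set
    x ~ y = ∃[ u ] ∃[ v ] Unipotentℤ u × Unipotentℤ v × γ y ≋ u · γ x · v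
      where open ℤᴹ using (_≋_; _·_)

    module _ where
      open ℤᴹ

      ~-refl : ∀ {x} → x ~ x
      ~-refl {x} = 1ᴹ , 1ᴹ , 1ᴹ-unipotent , 1ᴹ-unipotent ,
        ≋-sym (≋-trans (·-identityʳ (1ᴹ · γ x)) (·-identityˡ (γ x)))

      ~-sym : ∀ {x y} → x ~ y → y ~ x
      ~-sym {x} {y} (u , v , u-unip , v-unip , p) = inv u , inv v , inv-unipotent u , inv-unipotent v , ≋-sym
        (≋-trans (·-cong (·-cong (≋-refl {A = inv u}) p) (≋-refl {A = inv v}))
        (≋-trans (·-cong (·-cong (≋-refl {A = inv u}) (·-assoc u (γ x) v)) (≋-refl {A = inv v}))
        (≋-trans (·-cong (≋-sym (·-assoc (inv u) u (γ x · v))) (≋-refl {A = inv v}))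
        (≋-trans (·-cong (·-cong (·-inverseˡ u-unip) (≋-refl {A = γ x · v})) (≋-refl {A = inv v}))
        (≋-trans (·-cong (·-identityˡ (γ x · v)) (≋-refl {A = inv v}))
        (≋-trans (·-assoc (γ x) v (inv v))
        (≋-trans (·-cong (≋-refl {A = γ x}) (·-inverseʳ v-unip))
        (·-identityʳ (γ x)))))))))

      ~-trans : ∀ {x y z} → x ~ y → y ~ z → x ~ z
      ~-trans {x} {y} {z} (u , v , u-unip , v-unip , p) (u′ , v′ , u′-unip , v′-unip , q) =
        u′ · u , v · v′ , ·-unipotent u′-unip u-unip , ·-unipotent v-unip v′-unip ,
        ≋-trans q (≋-trans (·-cong (·-cong (≋-refl {A = u′}) p) (≋-refl {A = v′}))
        (≋-trans (·-cong (≋-sym (≋-trans (·-cong (·-assoc u′ u (γ x)) (≋-refl {A = v})) (·-assoc u′ (u · γ x) v))) (≋-refl {A = v′}))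
        (·-assoc (u′ · u · γ x) v v′)))

    X : Setoid (a ⊔ ℓ₁) _
    X = record { Carrier = Cell ; _≈_ = _~_ ; isEquivalence = record
      { refl = λ {x} → ~-refl {x} ; sym = λ {x} {y} → ~-sym {x} {y} ; trans = λ {x} {y} {z} → ~-trans {x} {y} {z} } }

    module Bℝ = Bruhat ℝ ι ι-mono.isRingHomomorphism

    InCell : Matℤ (suc r) (suc r) → Set
    InCell B = Unipotentℚ (left B) × Unipotentℚ (right B) × fromℤᴹ.image B ℚᴹ.≋ left B ℚᴹ.· cw₀ ℚᴹ.· right B

    b₁-rational : ∀ x → b₁ x ℝᴹ.≋ ιᴹ.image (left (γ x))
    b₁-rational x = Bℝ.left-unique (γ x) (b₁-unipotent x) (b₂-unipotent x) (bruhat x)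

    b₂-rational : ∀ x → b₂ x ℝᴹ.≋ ιᴹ.image (right (γ x))
    b₂-rational x = Bℝ.right-unique (γ x) (b₁-unipotent x) (b₂-unipotent x) (bruhat x)

    image-·· : ∀ (A B : Matℚ (suc r) (suc r)) → ιᴹ.image (A ℚᴹ.· cw₀ ℚᴹ.· B) ℝᴹ.≋ ιᴹ.image A ℝᴹ.· ιᴹ.image cw₀ ℝᴹ.· ιᴹ.image B
    image-·· A B = ℝᴹ.≋-trans (ιᴹ.·-homo (A ℚᴹ.· cw₀) B) (ℝᴹ.·-cong (ιᴹ.·-homo A cw₀) (ℝᴹ.≋-refl {A = ιᴹ.image B}))

    cell⇒inCell : ∀ x → InCell (γ x)
    cell⇒inCell x =
      ιᴹ.image-unipotent⁻¹ ι-mono.injective (ℝᴹ.unipotent-cong (b₁-rational x) (b₁-unipotent x)) ,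
      ιᴹ.image-unipotent⁻¹ ι-mono.injective (ℝᴹ.unipotent-cong (b₂-rational x) (b₂-unipotent x)) ,
      ιᴹ.≋-reflect ι-mono.injective {A = fromℤᴹ.image (γ x)} {left (γ x) ℚᴹ.· cw₀ ℚᴹ.· right (γ x)} (ℝᴹ.≋-trans (bruhat x) (ℝᴹ.≋-trans
        (ℝᴹ.·-cong (ℝᴹ.·-cong (b₁-rational x) (ℝᴹ.≋-refl {A = ιᴹ.image cw₀})) (b₂-rational x))
        (ℝᴹ.≋-sym (image-·· (left (γ x)) (right (γ x))))))

    fromRational : ∀ (B : Matℤ (suc r) (suc r)) (A A′ : Matℚ (suc r) (suc r)) → ℤᴹ.det B ≡ 1ℤ →
      Unipotentℚ A → Unipotentℚ A′ → fromℤᴹ.image B ℚᴹ.≋ A ℚᴹ.· cw₀ ℚᴹ.· A′ → Cell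
    fromRational B A A′ d u u′ p = record
      { γ = B ; det-γ = d ; b₁ = ιᴹ.image A ; b₂ = ιᴹ.image A′
      ; b₁-unipotent = ιᴹ.image-unipotent u ; b₂-unipotent = ιᴹ.image-unipotent u′
      ; bruhat = ℝᴹ.≋-trans (ιᴹ.image-cong p) (image-·· A A′) }

    translate : ∀ {B u v : Matℤ (suc r) (suc r)} {L R : Matℚ (suc r) (suc r)} → fromℤᴹ.image B ℚᴹ.≋ L ℚᴹ.· cw₀ ℚᴹ.· R →
      fromℤᴹ.image (u ℤᴹ.· B ℤᴹ.· v) ℚᴹ.≋ (fromℤᴹ.image u ℚᴹ.· L) ℚᴹ.· cw₀ ℚᴹ.· (R ℚᴹ.· fromℤᴹ.image v)
    translate {B} {u} {v} {L} {R} p =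
      ≋-trans (fromℤᴹ.·-homo (u ℤᴹ.· B) v)
      (≋-trans (·-cong (≋-trans (fromℤᴹ.·-homo u B) (·-cong (≋-refl {A = fromℤᴹ.image u}) p)) (≋-refl {A = fromℤᴹ.image v}))
      (·-assoc₅ (fromℤᴹ.image u) L cw₀ R (fromℤᴹ.image v)))
      where open ℚᴹ

    -- γ ↦ uγv sends (b₁, b₂) to (ub₁, b₂v).
    module _ {x y : Cell} {u v : Matℤ (suc r) (suc r)} (u-unip : Unipotentℤ u) (v-unip : Unipotentℤ v)
      (p : γ y ℤᴹ.≋ u ℤᴹ.· γ x ℤᴹ.· v) where
      private
        lx-unip = proj₁ (cell⇒inCell x)
        rx-unip = proj₁ (proj₂ (cell⇒inCell x))
        decomposes : ℚ-Bruhat.Decomposes (γ y) (fromℤᴹ.image u ℚᴹ.· left (γ x)) (right (γ x) ℚᴹ.· fromℤᴹ.image v)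
        decomposes = ℚᴹ.≋-trans (fromℤᴹ.image-cong p) (translate {γ x} {u} {v} {left (γ x)} {right (γ x)} (proj₂ (proj₂ (cell⇒inCell x))))

      left-translate : fromℤᴹ.image u ℚᴹ.· left (γ x) ℚᴹ.≋ left (γ y)
      left-translate = ℚ-Bruhat.left-unique (γ y)
        (ℚᴹ.·-unipotent (fromℤᴹ.image-unipotent u-unip) lx-unip) (ℚᴹ.·-unipotent rx-unip (fromℤᴹ.image-unipotent v-unip)) decomposes

      right-translate : right (γ x) ℚᴹ.· fromℤᴹ.image v ℚᴹ.≋ right (γ y)
      right-translate = ℚ-Bruhat.right-unique (γ y)
        (ℚᴹ.·-unipotent (fromℤᴹ.image-unipotent u-unip) lx-unip) (ℚᴹ.·-unipotent rx-unip (fromℤᴹ.image-unipotent v-unip)) decomposes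

    integer? : ∀ q → Dec (∃[ z ] fromℤ z ≡ q)
    integer? q with fromℤ (↥ q) ℚ.≟ q
    ... | yes p = yes (↥ q , p)
    ... | no ¬p = no λ { (z , ≡.refl) → ¬p (≡.cong fromℤ (↥-fromℤ z)) }

    integral? : ∀ {n} (A : Matℚ n n) → Dec (Σ[ u ∈ Matℤ n n ] fromℤᴹ.image u ℚᴹ.≋ A)
    integral? A = map′ (λ f → (λ i j → proj₁ (f i j)) , ℚᴹ.entrywise (λ i j → proj₂ (f i j))) (λ { (u , p) i j → u i j , p .ℚᴹ.at i j })
      (Fin.all? λ i → Fin.all? λ j → integer? (A i j))

    _~?_ : ∀ x y → Dec (x ~ y)
    x ~? y = map′ to from (integral? (left (γ y) · inv (left (γ x))) ×-dec integral? (inv (right (γ x)) · right (γ y)))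
      where
      open ℚᴹ
      lx = left (γ x)
      rx = right (γ x)
      ly = left (γ y)
      ry = right (γ y)
      lx-unip = proj₁ (cell⇒inCell x)
      rx-unip = proj₁ (proj₂ (cell⇒inCell x))
      ly-unip = proj₁ (cell⇒inCell y)
      ry-unip = proj₁ (proj₂ (cell⇒inCell y))
      to : (Σ[ u ∈ Matℤ _ _ ] fromℤᴹ.image u ≋ ly · inv lx) × Σ[ v ∈ Matℤ _ _ ] (fromℤᴹ.image v ≋ inv rx · ry) → x ~ y
      to ((u , p) , (v , q)) = u , v ,
        fromℤᴹ.image-unipotent⁻¹ fromℤ-injective (unipotent-cong (≋-sym p) (·-unipotent ly-unip (inv-unipotent lx))) ,
        fromℤᴹ.image-unipotent⁻¹ fromℤ-injective (unipotent-cong (≋-sym q) (·-unipotent (inv-unipotent rx) ry-unip)) ,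
        fromℤᴹ.≋-reflect fromℤ-injective {A = γ y} {u ℤᴹ.· γ x ℤᴹ.· v} (≋-trans (proj₂ (proj₂ (cell⇒inCell y))) (≋-sym (≋-trans
          (translate {γ x} {u} {v} {lx} {rx} (proj₂ (proj₂ (cell⇒inCell x))))
          (·-cong (·-cong ulx (≋-refl {A = cw₀})) rxv))))
        where
        ulx : fromℤᴹ.image u · lx ≋ ly
        ulx = ≋-trans (·-cong p (≋-refl {A = lx})) (≋-trans (·-assoc ly (inv lx) lx)
          (≋-trans (·-cong (≋-refl {A = ly}) (·-inverseˡ lx-unip)) (·-identityʳ ly)))
        rxv : rx · fromℤᴹ.image v ≋ ry
        rxv = ≋-trans (·-cong (≋-refl {A = rx}) q) (≋-trans (≋-sym (·-assoc rx (inv rx) ry))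
          (≋-trans (·-cong (·-inverseʳ rx-unip) (≋-refl {A = ry})) (·-identityˡ ry)))
      from : x ~ y → (Σ[ u ∈ Matℤ _ _ ] fromℤᴹ.image u ≋ ly · inv lx) × Σ[ v ∈ Matℤ _ _ ] (fromℤᴹ.image v ≋ inv rx · ry)
      from (u , v , u-unip , v-unip , p) = (u , pu) , (v , pv)
        where
        pu : fromℤᴹ.image u ≋ ly · inv lx
        pu = ≋-sym (≋-trans (·-cong (≋-sym (left-translate {x} {y} u-unip v-unip p)) (≋-refl {A = inv lx}))
          (≋-trans (·-assoc (fromℤᴹ.image u) lx (inv lx))
          (≋-trans (·-cong (≋-refl {A = fromℤᴹ.image u}) (·-inverseʳ lx-unip)) (·-identityʳ (fromℤᴹ.image u)))))
        pv : fromℤᴹ.image v ≋ inv rx · ry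
        pv = ≋-sym (≋-trans (·-cong (≋-refl {A = inv rx}) (≋-sym (right-translate {x} {y} u-unip v-unip p)))
          (≋-trans (≋-sym (·-assoc (inv rx) rx (fromℤᴹ.image v)))
          (≋-trans (·-cong (·-inverseˡ rx-unip) (≋-refl {A = fromℤᴹ.image v})) (·-identityˡ (fromℤᴹ.image v)))))

    bound : ℚ
    bound = ℚᴹ.sum (λ l → ∣ pivot l ∣)

    candidates : ℕ → List (Matℤ (suc r) (suc r))
    candidates K = vectors (vectors (integers K) (suc r)) (suc r)

    candidates-complete : ∀ K (B : Matℤ (suc r) (suc r)) → (∀ i j → ℤ.∣ B i j ∣ ℕ.≤ K) → Any (B ℤᴹ.≋_) (candidates K)
    candidates-complete K B p = Any.map ℤᴹ.entrywise
      (vectors-complete (λ f g → ∀ j → f j ≡ g j) B λ i → vectors-complete _≡_ (B i) λ j → integers-complete (B i j) (p i j))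

    reduce : ∀ x → Σ[ y ∈ Cell ] x ~ y × (∀ i j → ∣ fromℤ (γ y i j) ∣ ℚ.≤ bound)
    reduce x = y , (u , v , u-unip , v-unip , ℤᴹ.≋-refl) , small
      where
      lx = left (γ x)
      rx = right (γ x)
      x-cell = cell⇒inCell x
      redˡ = reduceˡ (proj₁ x-cell)
      redʳ = reduceʳ (proj₁ (proj₂ x-cell))
      u = proj₁ redˡ
      u-unip = proj₁ (proj₂ redˡ)
      v = proj₁ redʳ
      v-unip = proj₁ (proj₂ redʳ)
      open Determinants ℤ-ring
      y : Cell
      y = fromRational (u ℤᴹ.· γ x ℤᴹ.· v) (fromℤᴹ.image u ℚᴹ.· lx) (rx ℚᴹ.· fromℤᴹ.image v)
        (≡.trans (det-· (u ℤᴹ.· γ x) v) (≡.cong₂ ℤ._*_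
          (≡.trans (det-· u (γ x)) (≡.cong₂ ℤ._*_ (det-unipotent u-unip) (det-γ x)))
          (det-unipotent v-unip)))
        (ℚᴹ.·-unipotent (fromℤᴹ.image-unipotent u-unip) (proj₁ x-cell))
        (ℚᴹ.·-unipotent (proj₁ (proj₂ x-cell)) (fromℤᴹ.image-unipotent v-unip))
        (translate {γ x} {u} {v} {lx} {rx} (proj₂ (proj₂ x-cell)))
      small : ∀ i j → ∣ fromℤ (γ y i j) ∣ ℚ.≤ bound
      small i j = ≡.subst (λ q → ∣ q ∣ ℚ.≤ bound) (≡.sym (≡.trans (translate {γ x} {u} {v} {lx} {rx} (proj₂ (proj₂ x-cell)) .ℚᴹ.at i j)
        (ℚ-Bruhat.expand (fromℤᴹ.image u ℚᴹ.· lx) (rx ℚᴹ.· fromℤᴹ.image v) i j)))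
        (∣sum∣≤ λ l → ∣xyz∣≤∣y∣ {y = pivot l} (proj₂ (proj₂ redˡ) i (opposite l)) (proj₂ (proj₂ redʳ) l j))

    unipotent? : ∀ {n} (A : Matℚ n n) → Dec (Unipotentℚ A)
    unipotent? A = map′ (λ (p , q) → record { diag = p ; below = λ {i} {j} → q i j }) (λ u → u .ℚᴹ.diag , λ i j → u .ℚᴹ.below)
      (Fin.all? (λ i → A i i ℚ.≟ 1ℚ) ×-dec Fin.all? λ i → Fin.all? λ j → (j Fin.<? i) →-dec (A i j ℚ.≟ 0ℚ))

    inCell? : ∀ B → Dec (InCell B)
    inCell? B = unipotent? (left B) ×-dec unipotent? (right B) ×-dec
      map′ ℚᴹ.entrywise ℚᴹ.at (Fin.all? λ i → Fin.all? λ j → fromℤ (B i j) ℚ.≟ (left B ℚᴹ.· cw₀ ℚᴹ.· right B) i j)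

    cellOf : ∀ B → Dec (ℤᴹ.det B ≡ 1ℤ × InCell B) → List Cell
    cellOf B (yes (d , u , u′ , p)) = List.[ fromRational B (left B) (right B) d u u′ p ]
    cellOf B (no _) = List.[]

    cellOf-complete : ∀ x B dec → γ x ℤᴹ.≋ B → Any (x ~_) (cellOf B dec)
    cellOf-complete x B (yes _) γ≋B = here (1ᴹ , 1ᴹ , 1ᴹ-unipotent , 1ᴹ-unipotent ,
      ≋-sym (≋-trans (·-identityʳ (1ᴹ · γ x)) (≋-trans (·-identityˡ (γ x)) γ≋B)))
      where open ℤᴹ
    cellOf-complete x B (no ¬p) γ≋B = ⊥-elim (¬p (d , cell⇒inCell x′))
      where
      d : ℤᴹ.det B ≡ 1ℤ
      d = ≡.trans (≡.sym (Determinants.det-cong ℤ-ring γ≋B)) (det-γ x)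
      x′ : Cell
      x′ = record { γ = B ; det-γ = d ; b₁ = b₁ x ; b₂ = b₂ x ; b₁-unipotent = b₁-unipotent x ; b₂-unipotent = b₂-unipotent x
                  ; bruhat = ℝᴹ.≋-trans (ιᴹ.image-cong (fromℤᴹ.image-cong (ℤᴹ.≋-sym γ≋B))) (bruhat x) }

    cell? : ∀ B → Dec (ℤᴹ.det B ≡ 1ℤ × InCell B)
    cell? B = (ℤᴹ.det B ℤ.≟ 1ℤ) ×-dec inCell? B

    cellAt : Matℤ (suc r) (suc r) → List Cell
    cellAt B = cellOf B (cell? B)

    cells : ℕ → List Cell
    cells K = List.concatMap cellAt (candidates K)

    cells-complete : ∀ K x y → x ~ y → (∀ i j → ℤ.∣ γ y i j ∣ ℕ.≤ K) → Any (x ~_) (cells K)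
    cells-complete K x y x~y p = Any.map (λ {z} → ~-trans {x} {y} {z} x~y)
      (Any.concatMap⁺ cellAt (Any.map (λ {B} → cellOf-complete y B (cell? B)) (candidates-complete K (γ y) p)))

    abstract
      X-finite : Finite X
      X-finite = enumerate _~?_ (cells ℤ.∣ ↥ bound ∣) λ x →
        let y , x~y , small = reduce x in
        cells-complete ℤ.∣ ↥ bound ∣ x y x~y λ i j → ∣fromℤ∣≤⇒ (γ y i j) bound (small i j)

    -- ψ_M̃(μ(x)) ψ_N(μ′(x)).
    weight : Vector ℤ r → Vector ℤ r → Cell → ℂ.Carrier
    weight M N x = ψ (reverse M) (b₁ x) ℂ.* ψ N (b₂ x)

    weight-cong : ∀ M N {x y} → x ~ y → weight M N x ℂ.≈ weight M N y
    weight-cong M N {x} {y} (u , v , u-unip , v-unip , p) = ℂ.*-cong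
      (ψ-translate (reverse M) (λ i → u (inject₁ i) (suc i)) (b₁ x) (b₁ y) shift₁)
      (ψ-translate N (λ i → v (inject₁ i) (suc i)) (b₂ x) (b₂ y) shift₂)
      where
      open import Relation.Binary.Reasoning.Setoid ℝ.setoid
      lx = left (γ x)
      rx = right (γ x)
      lx-unip = proj₁ (cell⇒inCell x)
      rx-unip = proj₁ (proj₂ (cell⇒inCell x))
      shift₁ : ∀ i → b₁ y (inject₁ i) (suc i) ℝ.≈ ιℤ (u (inject₁ i) (suc i)) ℝ.+ b₁ x (inject₁ i) (suc i)
      shift₁ i = begin
        b₁ y j k                              ≈⟨ b₁-rational y .ℝᴹ.at j k ⟩
        ι (left (γ y) j k)                    ≈⟨ ι-mono.⟦⟧-cong (left-translate {x} {y} u-unip v-unip p .ℚᴹ.at j k) ⟨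
        ι ((fromℤᴹ.image u ℚᴹ.· lx) j k)     ≈⟨ ι-mono.⟦⟧-cong (ℚᴹ.superdiagonal-· (fromℤᴹ.image-unipotent u-unip) lx-unip i) ⟩
        ι (fromℤ (u j k) ℚ.+ lx j k)          ≈⟨ ι-mono.+-homo (fromℤ (u j k)) (lx j k) ⟩
        ιℤ (u j k) ℝ.+ ι (lx j k)             ≈⟨ ℝ.+-congˡ (b₁-rational x .ℝᴹ.at j k) ⟨
        ιℤ (u j k) ℝ.+ b₁ x j k               ∎
        where
        j = inject₁ i
        k = suc i
      shift₂ : ∀ i → b₂ y (inject₁ i) (suc i) ℝ.≈ ιℤ (v (inject₁ i) (suc i)) ℝ.+ b₂ x (inject₁ i) (suc i)
      shift₂ i = begin
        b₂ y j k                              ≈⟨ b₂-rational y .ℝᴹ.at j k ⟩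
        ι (right (γ y) j k)                   ≈⟨ ι-mono.⟦⟧-cong (right-translate {x} {y} u-unip v-unip p .ℚᴹ.at j k) ⟨
        ι ((rx ℚᴹ.· fromℤᴹ.image v) j k)     ≈⟨ ι-mono.⟦⟧-cong (ℚᴹ.superdiagonal-· rx-unip (fromℤᴹ.image-unipotent v-unip) i) ⟩
        ι (rx j k ℚ.+ fromℤ (v j k))          ≈⟨ ι-mono.+-homo (rx j k) (fromℤ (v j k)) ⟩
        ι (rx j k) ℝ.+ ιℤ (v j k)             ≈⟨ ℝ.+-comm (ι (rx j k)) (ιℤ (v j k)) ⟩
        ιℤ (v j k) ℝ.+ ι (rx j k)             ≈⟨ ℝ.+-congˡ (b₂-rational x .ℝᴹ.at j k) ⟨
        ιℤ (v j k) ℝ.+ b₂ x j k               ∎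
        where
        j = inject₁ i
        k = suc i

    phase : Vector ℤ r → Vector ℤ r → Func X ℂ.setoid
    phase M N = record { to = weight M N ; cong = λ {x} {y} → weight-cong M N {x} {y} }

  S : ∀ {r} (M N : Vector ℤ r) (D : Vector ℕ r) → (∀ i → NonZero (D i)) → ℂ.Carrier
  S M N D D>0 = ∑ ℂ (X-finite D D>0) (phase D D>0 M N)

-- The sums are matched term by term by the automorphism θ(γ) = w₀(γ⁻¹)ᵀw₀⁻¹ of
-- SL(n, ℤ).  It preserves U and reverses the order of the superdiagonal
-- entries there, fixes w₀, and sends the torus element of D to that of D̃; so
-- b₁cw₀b₂ goes to θ(b₁)c̃w₀θ(b₂), and θ induces a bijection from X(c) to X(c̃)
-- under which the characters of M and N become those of M̃ and Ñ.

module Submission where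

open import Defs
open import Algebra.Bundles using (CommutativeRing)
open import Algebra.Morphism.Structures using (module RingMorphisms; module MonoidMorphisms)
open import Data.Fin.Base as Fin using (Fin; zero; suc; toℕ; fromℕ; inject₁; opposite; punchIn; punchOut)
import Data.Fin.Permutation as Permutation
import Data.Fin.Properties as Fin
open import Data.Fin.Relation.Unary.Top using (view; ‵fromℕ; ‵inject₁)
open import Data.Integer.Base using (ℤ; +_; 1ℤ)
open import Data.Nat.Base as ℕ using (ℕ; zero; suc; _≤_; s≤s; NonZero)
import Data.Nat.Properties as ℕ
open import Data.Nat.Tactic.RingSolver using (solve-∀)
open import Data.Product.Base using (_,_; proj₁; proj₂)
open import Data.Rational.Base as ℚ using (ℚ; 1ℚ)
import Data.Rational.Properties as ℚ
open import Data.Vec.Functional using (Vector; _∷_; insertAt; reverse)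
open import Data.Vec.Functional.Properties using (insertAt-lookup)
open import Function.Base using (_∘_)
open import Function.Bundles using (Func; Inverse)
import Function.Construct.Composition as Composition
import Function.Construct.Symmetry as Symmetry
open import Function.Properties.Bijection using (Bijection⇒Inverse)
open import Relation.Binary.Bundles using (Setoid)
open import Relation.Binary.PropositionalEquality as ≡ using (_≡_)
open import Relation.Nullary using (Dec; yes; no)

-- Reversal of finite indices.

opposite-inject₁ : ∀ {n} (i : Fin n) → opposite (inject₁ i) ≡ suc (opposite i)
opposite-inject₁ zero    = ≡.refl
opposite-inject₁ (suc i) = ≡.cong inject₁ (opposite-inject₁ i)

opposite-swap : ∀ {n} {i j : Fin n} → i ≡ opposite j → opposite i ≡ j
opposite-swap p = ≡.trans (≡.cong opposite p) (Fin.opposite-involutive _)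

toℕ-opposite : ∀ {n} (i : Fin (suc n)) → toℕ i ℕ.+ toℕ (opposite i) ≡ n
toℕ-opposite {n} i = ≡.trans (≡.cong (toℕ i ℕ.+_) (Fin.opposite-prop i))
  (ℕ.m+[n∸m]≡n (ℕ.≤-pred (Fin.toℕ<n i)))

opposite-< : ∀ {n} {i j : Fin n} → i Fin.< j → opposite j Fin.< opposite i
opposite-< {n} {i} {j} i<j = ≡.subst₂ ℕ._<_ (≡.sym (Fin.opposite-prop j)) (≡.sym (Fin.opposite-prop i))
  (ℕ.∸-monoʳ-< (s≤s i<j) (Fin.toℕ<n j))

-- Inverses and adjugates over a commutative ring.

module MatrixInverses {c ℓ} (R : CommutativeRing c ℓ) where

  open Matrices R
  open Determinants R
  open import Algebra.Properties.Semiring.Exp semiring using (^-congˡ; ^-homo-*; ^-assocʳ)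
  open import Algebra.Properties.Ring ring using (-1*x≈-x; -‿involutive; +-inverseʳ-unique)
  open import Algebra.Solver.Ring.NaturalCoefficients.Default commutativeSemiring
  open import Relation.Binary.Reasoning.Setoid setoid

  -- The means of computing adjugates: the adjugate of a matrix of determinant 1 is a right inverse,
  -- so it agrees with any left inverse that can be exhibited.
  inverse-unique : ∀ {n} {X A Y : Mat n n} → X · A ≋ 1ᴹ → A · Y ≋ 1ᴹ → X ≋ Y
  inverse-unique {X = X} {A} {Y} p q =
    ≋-trans (≋-sym (·-identityʳ X)) (≋-trans (·-cong (≋-refl {A = X}) (≋-sym q))
    (≋-trans (≋-sym (·-assoc X A Y)) (≋-trans (·-cong p (≋-refl {A = Y})) (·-identityˡ Y))))

  ·-cancelˡ : ∀ {n} {X A : Mat n n} (B : Mat n n) → X · A ≋ 1ᴹ → X · (A · B) ≋ B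
  ·-cancelˡ {X = X} {A} B p = ≋-trans (≋-sym (·-assoc X A B))
    (≋-trans (·-cong p (≋-refl {A = B})) (·-identityˡ B))

  ·₃-inverse : ∀ {n} {A B C A′ B′ C′ : Mat n n} → A′ · A ≋ 1ᴹ → B′ · B ≋ 1ᴹ → C′ · C ≋ 1ᴹ →
    (C′ · B′ · A′) · (A · B · C) ≋ 1ᴹ
  ·₃-inverse {A = A} {B} {C} {A′} {B′} {C′} p q r =
    ≋-trans (·-assoc (C′ · B′) A′ (A · B · C))
    (≋-trans (·-cong (≋-refl {A = C′ · B′}) (·-cong (≋-refl {A = A′}) (·-assoc A B C)))
    (≋-trans (·-cong (≋-refl {A = C′ · B′}) (·-cancelˡ (B · C) p))
    (≋-trans (·-assoc C′ B′ (B · C))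
    (≋-trans (·-cong (≋-refl {A = C′}) (·-cancelˡ C q)) r))))

  -- Rotating row `l` to the top puts the two equal rows next to each other, where `det-alt`
  -- applies.
  det-repeat : ∀ {n} (x : Vector Carrier (suc n)) (X : Mat n (suc n)) l →
    (∀ j → X l j ≈ x j) → det (x ∷ X) ≈ 0#
  det-repeat {suc n} x X l p = trans (det-rotate (x ∷ X) (suc l)) (*-zero {x = sign (suc l)} (trans
    (det-cong {A = X l ∷ ((x ∷ X) ∘ punchIn (suc l))} {x ∷ x ∷ (X ∘ punchIn l)}
      (entrywise λ { zero j → p j ; (suc zero) j → refl ; (suc (suc i)) j → refl }))
    (det-alt x x (X ∘ punchIn l))))

  adjugate : ∀ {n} → Mat (suc n) (suc n) → Mat (suc n) (suc n)
  adjugate A j k = sign j * (sign k * det (λ a b → A (punchIn k a) (punchIn j b)))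

  module _ {n} {A : Mat (suc n) (suc n)} (det≈1 : det A ≈ 1#) where

    -- Up to `sign k`, entry `(i, k)` is the Laplace expansion of the matrix with top row `A i`
    -- followed by the rows of `A` other than row `k`. For `i = k` this is a rotation of `A`;
    -- otherwise row `i` occurs twice.
    ·-adjugate : A · adjugate A ≋ 1ᴹ
    ·-adjugate .at i k = begin
      ∑[ j < suc n ] (A i j * (sign j * (sign k * d j)))
        ≈⟨ sum-cong-≋ (λ j → solve 4 (λ a s t d → a :* (s :* (t :* d)) := t :* (s :* (a :* d))) refl (A i j) (sign j) (sign k) (d j)) ⟩
      ∑[ j < suc n ] (sign k * (sign j * (A i j * d j)))
        ≈⟨ *-distribˡ-sum (sign k) (λ j → sign j * (A i j * d j)) ⟨
      sign k * det (A i ∷ (A ∘ punchIn k))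
        ≈⟨ entry ⟩
      1ᴹ i k ∎
      where
      d : Vector Carrier (suc n)
      d j = det (λ a b → A (punchIn k a) (punchIn j b))
      entry : sign k * det (A i ∷ (A ∘ punchIn k)) ≈ 1ᴹ i k
      entry with k Fin.≟ i
      ... | yes ≡.refl = trans (sym (det-rotate A k)) (trans det≈1 (sym (diagonal-≡ _ k)))
      ... | no k≢i = trans
        -- Row `i` survives the deletion of row `k`, at position `punchOut k≢i`.
        (*-zero {x = sign k} (det-repeat (A i) (A ∘ punchIn k) (punchOut k≢i)
          λ j → reflexive (≡.cong (λ l → A l j) (Fin.punchIn-punchOut k≢i))))
        (sym (diagonal-≢ _ (k≢i ∘ ≡.sym)))

    det-adjugate : det (adjugate A) ≈ 1#
    det-adjugate = begin
      det (adjugate A)           ≈⟨ *-identityˡ _ ⟨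
      1# * det (adjugate A)      ≈⟨ *-congʳ det≈1 ⟨
      det A * det (adjugate A)   ≈⟨ det-· A (adjugate A) ⟨
      det (A · adjugate A)       ≈⟨ det-cong {A = A · adjugate A} {1ᴹ} ·-adjugate ⟩
      det (1ᴹ {suc n})           ≈⟨ det-unipotent {A = 1ᴹ {suc n}} 1ᴹ-unipotent ⟩
      1#                         ∎

  -- The adjugate `A′` has determinant 1, so it has a right inverse of its own. As `A` is a left
  -- inverse of `A′`, the two coincide, and the right inverse law for `A′` becomes the left inverse
  -- law for `A`.
  adjugate-· : ∀ {n} {A : Mat (suc n) (suc n)} → det A ≈ 1# → adjugate A · A ≋ 1ᴹ
  adjugate-· {A = A} d = ≋-trans
    (·-cong {A = A′} {B = A} {adjugate A′} (≋-refl {A = A′})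
      (inverse-unique {X = A} {A′} {adjugate A′} (·-adjugate {A = A} d) p))
    p
    where
    A′ = adjugate A
    p : A′ · adjugate A′ ≋ 1ᴹ
    p = ·-adjugate {A = A′} (det-adjugate {A = A} d)

  -- Scalar determinants and powers of -1.

  det-scalar : ∀ n x → det (diagonal {n} (λ _ → x)) ≈ x ^ n
  det-scalar zero    x = refl
  det-scalar (suc n) x = begin
    det A                                   ≈⟨ sum-single {t = λ j → sign j * (A zero j * det (minor A j))} zero
                                                  (λ j j≢0 → *-zero {x = sign j} (zero-* (diagonal-≢ (λ _ → x) (j≢0 ∘ ≡.sym)))) ⟩
    1# * (A zero zero * det (minor A zero)) ≈⟨ *-identityˡ _ ⟩
    A zero zero * det (minor A zero)        ≈⟨ *-cong (diagonal-≡ {suc n} (λ _ → x) zero) (trans (det-cong {A = minor A zero} {diagonal (λ _ → x)} (entrywise minor-scalar)) (det-scalar n x)) ⟩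
    x * x ^ n                               ∎
    where
    A = diagonal {suc n} (λ _ → x)
    minor-scalar : ∀ i j → A (suc i) (suc j) ≈ diagonal (λ _ → x) i j
    minor-scalar i j = go (i Fin.≟ j)
      where
      go : Dec (i ≡ j) → A (suc i) (suc j) ≈ diagonal (λ _ → x) i j
      go (yes ≡.refl) = trans (diagonal-≡ _ (suc i)) (sym (diagonal-≡ _ i))
      go (no i≢j) = trans (diagonal-≢ _ (i≢j ∘ Fin.suc-injective)) (sym (diagonal-≢ _ i≢j))

  [-1]² : - 1# * - 1# ≈ 1#
  [-1]² = trans (-1*x≈-x (- 1#)) (-‿involutive 1#)

  1^n≈1 : ∀ n → 1# ^ n ≈ 1#
  1^n≈1 zero    = refl
  1^n≈1 (suc n) = trans (*-identityˡ _) (1^n≈1 n)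

  [-1]^2n : ∀ n → (- 1#) ^ (2 ℕ.* n) ≈ 1#
  [-1]^2n n = begin
    (- 1#) ^ (2 ℕ.* n)   ≈⟨ ^-assocʳ (- 1#) 2 n ⟨
    ((- 1#) ^ 2) ^ n     ≈⟨ ^-congˡ n (trans (*-congˡ (*-identityʳ (- 1#))) [-1]²) ⟩
    1# ^ n               ≈⟨ 1^n≈1 n ⟩
    1#                   ∎

  -- The exponent `n (n + 1)` is even. This evaluates the determinant of the scalar matrix (-1)ⁿ of
  -- size `n + 1`.
  [-1]^n[n+1] : ∀ n → ((- 1#) ^ n) ^ suc n ≈ 1#
  [-1]^n[n+1] n = trans (^-assocʳ (- 1#) n (suc n)) (go n)
    where
    go : ∀ n → (- 1#) ^ (n ℕ.* suc n) ≈ 1#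
    go zero    = refl
    go (suc n) = begin
      (- 1#) ^ (suc n ℕ.* suc (suc n))                      ≡⟨ ≡.cong ((- 1#) ^_) (arith n) ⟩
      (- 1#) ^ (n ℕ.* suc n ℕ.+ 2 ℕ.* suc n)                ≈⟨ ^-homo-* (- 1#) (n ℕ.* suc n) (2 ℕ.* suc n) ⟩
      (- 1#) ^ (n ℕ.* suc n) * (- 1#) ^ (2 ℕ.* suc n)       ≈⟨ *-cong (go n) ([-1]^2n (suc n)) ⟩
      1# * 1#                                               ≈⟨ *-identityˡ 1# ⟩
      1#                                                    ∎
      where
      arith : ∀ n → suc n ℕ.* suc (suc n) ≡ n ℕ.* suc n ℕ.+ 2 ℕ.* suc n
      arith = solve-∀

  sign² : ∀ {n} (i : Fin n) → sign i * sign i ≈ 1#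
  sign² i = trans (sym (^-homo-* (- 1#) (toℕ i) (toℕ i)))
    (trans (reflexive (≡.cong (λ k → (- 1#) ^ (toℕ i ℕ.+ k)) (≡.sym (ℕ.+-identityʳ (toℕ i))))) ([-1]^2n (toℕ i)))

  -- The indices `i` and `opposite i` add up to `n`, so the product is the same for all `i`: w₀² is
  -- a scalar matrix.
  sign-opposite : ∀ {n} (i : Fin (suc n)) → sign i * sign (opposite i) ≈ (- 1#) ^ n
  sign-opposite i = trans (sym (^-homo-* (- 1#) (toℕ i) (toℕ (opposite i))))
    (reflexive (≡.cong ((- 1#) ^_) (toℕ-opposite i)))

  -- The transpose conjugated by w₀.

  infix 9 _♯

  -- w₀Aᵀw₀⁻¹.
  _♯ : ∀ {n} → Mat n n → Mat n n
  (A ♯) i j = sign i * sign j * A (opposite j) (opposite i)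

  ♯-cong : ∀ {n} {A B : Mat n n} → A ≋ B → A ♯ ≋ B ♯
  ♯-cong p .at i j = *-congˡ (p .at (opposite j) (opposite i))

  -- Transposition reverses products. Conjugation by w₀ appears as a reversal of the summation
  -- index, and `sign k * sign k = 1` is inserted to supply the inner signs of the two factors.
  ♯-· : ∀ {n} (A B : Mat n n) → (A · B) ♯ ≋ B ♯ · A ♯
  ♯-· {n} A B .at i j = begin
    sign i * sign j * ∑[ k < n ] (A j′ k * B k i′)
      ≈⟨ *-congˡ (sum-permute (λ k → A j′ k * B k i′) Permutation.reverse) ⟩
    sign i * sign j * ∑[ k < n ] (A j′ (opposite k) * B (opposite k) i′)
      ≈⟨ *-distribˡ-sum (sign i * sign j) (λ k → A j′ (opposite k) * B (opposite k) i′) ⟩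
    ∑[ k < n ] (sign i * sign j * (A j′ (opposite k) * B (opposite k) i′))
      ≈⟨ sum-cong-≋ (λ k → trans (sym (*-identityˡ _)) (trans (*-congʳ (sym (sign² k)))
           (solve 5 (λ s t u a b → u :* u :* (s :* t :* (a :* b)) := s :* u :* b :* (u :* t :* a)) refl
             (sign i) (sign j) (sign k) (A j′ (opposite k)) (B (opposite k) i′)))) ⟩
    ∑[ k < n ] ((B ♯) i k * (A ♯) k j) ∎
    where
    i′ = opposite i
    j′ = opposite j

  ♯-·₃ : ∀ {n} (A B C : Mat n n) → (A · B · C) ♯ ≋ C ♯ · B ♯ · A ♯
  ♯-·₃ A B C = ≋-trans (♯-· (A · B) C) (≋-trans (·-cong (≋-refl {A = C ♯}) (♯-· A B)) (≋-sym (·-assoc (C ♯) (B ♯) (A ♯))))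

  -- The four signs multiply to the square of `(- 1#) ^ n`. Conceptually, applying ♯ twice is
  -- conjugation by the scalar matrix w₀².
  ♯-involutive : ∀ {n} (A : Mat n n) → A ♯ ♯ ≋ A
  ♯-involutive {suc n} A .at i j = begin
    s i * s j * (s (opposite j) * s (opposite i) * A (opposite (opposite i)) (opposite (opposite j)))
      ≈⟨ solve 5 (λ a b c d e → a :* b :* (c :* d :* e) := a :* d :* (b :* c) :* e) refl
           (s i) (s j) (s (opposite j)) (s (opposite i)) (A (opposite (opposite i)) (opposite (opposite j))) ⟩
    s i * s (opposite i) * (s j * s (opposite j)) * A (opposite (opposite i)) (opposite (opposite j))
      ≈⟨ *-cong (trans (*-cong (sign-opposite i) (trans (sign-opposite j) (sym (sign-opposite i)))) square)
           (reflexive (≡.cong₂ A (Fin.opposite-involutive i) (Fin.opposite-involutive j))) ⟩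
    1# * A i j
      ≈⟨ *-identityˡ _ ⟩
    A i j ∎
    where
    s = sign {suc n}
    square : (- 1#) ^ n * (s i * s (opposite i)) ≈ 1#
    square = trans (*-congˡ (sign-opposite i)) (trans (sym (^-homo-* (- 1#) n n))
      (trans (reflexive (≡.cong (λ k → (- 1#) ^ (n ℕ.+ k)) (≡.sym (ℕ.+-identityʳ n)))) ([-1]^2n n)))

  ♯-unipotent : ∀ {n} {A : Mat n n} → Unipotent A → Unipotent (A ♯)
  ♯-unipotent u .diag i = trans (*-cong (sign² i) (u .diag (opposite i))) (*-identityˡ 1#)
  ♯-unipotent u .below j<i = *-zero (u .below (opposite-< j<i))

  ♯-1ᴹ : ∀ {n} → 1ᴹ {n} ♯ ≋ 1ᴹ
  ♯-1ᴹ {n} .at i j with i Fin.≟ j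
  ... | yes ≡.refl = ♯-unipotent (1ᴹ-unipotent {n}) .diag i
  ... | no i≢j = *-zero (diagonal-≢ _ λ p → i≢j (≡.sym (≡.trans (≡.sym (Fin.opposite-involutive j)) (opposite-swap p))))

  ♯-inverse : ∀ {n} {A B : Mat n n} → A · B ≋ 1ᴹ → B ♯ · A ♯ ≋ 1ᴹ
  ♯-inverse {A = A} {B} p = ≋-trans (≋-sym (♯-· A B)) (≋-trans (♯-cong p) ♯-1ᴹ)

  -- Superdiagonal entries add up in a product of unipotent matrices, and those of `1ᴹ` vanish.
  inv-superdiagonal : ∀ {n} {A : Mat (suc n) (suc n)} → Unipotent A → ∀ i →
    inv A (inject₁ i) (suc i) ≈ - A (inject₁ i) (suc i)
  inv-superdiagonal {A = A} u i = +-inverseʳ-unique _ _ (begin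
    A (inject₁ i) (suc i) + inv A (inject₁ i) (suc i) ≈⟨ superdiagonal-· u (inv-unipotent A) i ⟨
    (A · inv A) (inject₁ i) (suc i)                   ≈⟨ ·-inverseʳ u .at (inject₁ i) (suc i) ⟩
    1ᴹ (inject₁ i) (suc i)                            ≈⟨ diagonal-≢ _ (Fin.<⇒≢ (s≤s (ℕ.≤-reflexive (Fin.toℕ-inject₁ i)))) ⟩
    0#                                                ∎)

  -- Both the inverse and ♯ negate the superdiagonal, and ♯ reverses it.
  inv♯-superdiagonal : ∀ {n} {A : Mat (suc n) (suc n)} → Unipotent A → ∀ i →
    (inv A ♯) (inject₁ i) (suc i) ≈ A (inject₁ (opposite i)) (suc (opposite i))
  inv♯-superdiagonal {A = A} u i = begin
    sign (inject₁ i) * (- 1# * sign i) * inv A (inject₁ i′) (opposite (inject₁ i))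
      ≡⟨ ≡.cong₂ (λ k l → (- 1#) ^ k * (- 1# * sign i) * inv A (inject₁ i′) l) (Fin.toℕ-inject₁ i) (opposite-inject₁ i) ⟩
    sign i * (- 1# * sign i) * inv A (inject₁ i′) (suc i′)
      ≈⟨ *-congˡ (trans (inv-superdiagonal u i′) (sym (-1*x≈-x _))) ⟩
    sign i * (- 1# * sign i) * (- 1# * a)
      ≈⟨ solve 3 (λ s m a → s :* (m :* s) :* (m :* a) := s :* s :* (m :* m) :* a) refl (sign i) (- 1#) a ⟩
    sign i * sign i * (- 1# * - 1#) * a
      ≈⟨ *-congʳ (trans (*-cong (sign² i) [-1]²) (*-identityˡ 1#)) ⟩
    1# * a
      ≈⟨ *-identityˡ a ⟩
    a ∎
    where
    i′ = opposite i
    a = A (inject₁ i′) (suc i′)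

-- Signs, determinants and inverses under ring homomorphisms.

module HomomorphicImages {a ℓ₁ b ℓ₂} (R : CommutativeRing a ℓ₁) (S : CommutativeRing b ℓ₂)
  (φ : CommutativeRing.Carrier R → CommutativeRing.Carrier S) (φ-hom : IsHomomorphism R S φ) where

  private
    module R where
      open Matrices R public
      open MatrixInverses R public
    module S where
      open Matrices S public
      open MatrixInverses S public
    module φ = RingMorphisms.IsRingHomomorphism φ-hom

  open Homomorphism R S φ φ-hom

  sign-homo : ∀ {n} (i : Fin n) → φ (R.sign i) S.≈ S.sign i
  sign-homo i = go (toℕ i)
    where
    go : ∀ k → φ ((R.- R.1#) R.^ k) S.≈ (S.- S.1#) S.^ k
    go zero    = φ.1#-homo
    go (suc k) = S.trans (φ.*-homo _ _) (S.*-cong (S.trans (φ.-‿homo _) (S.-‿cong φ.1#-homo)) (go k))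

  det-homo : ∀ {n} (A : R.Mat n n) → φ (R.det A) S.≈ S.det (image A)
  det-homo {zero}  A = φ.1#-homo
  det-homo {suc n} A = S.trans (sum-homo (λ j → R.sign j R.* (A zero j R.* R.det (R.minor A j))))
    (S.sum-cong-≋ λ j → S.trans (φ.*-homo _ _) (S.*-cong (sign-homo j)
      (S.trans (φ.*-homo (A zero j) _) (S.*-congˡ {φ (A zero j)} (det-homo (R.minor A j))))))

  ♯-homo : ∀ {n} (A : R.Mat n n) → image (A R.♯) S.≋ image A S.♯
  ♯-homo A .S.at i j = S.trans (φ.*-homo _ _) (S.*-congʳ (S.trans (φ.*-homo _ _) (S.*-cong (sign-homo i) (sign-homo j))))

  image-1ᴹ : ∀ {n} → image (R.1ᴹ {n}) S.≋ S.1ᴹ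
  image-1ᴹ .S.at i j = go (i Fin.≟ j)
    where
    go : Dec (i ≡ j) → φ (R.1ᴹ i j) S.≈ S.1ᴹ i j
    go (yes ≡.refl) = S.trans (φ.⟦⟧-cong (R.diagonal-≡ _ i)) (S.trans φ.1#-homo (S.sym (S.diagonal-≡ _ i)))
    go (no i≢j) = S.trans (φ.⟦⟧-cong (R.diagonal-≢ _ i≢j)) (S.trans φ.0#-homo (S.sym (S.diagonal-≢ _ i≢j)))

  image-inverse : ∀ {n} {A B : R.Mat n n} → A R.· B R.≋ R.1ᴹ → image A S.· image B S.≋ S.1ᴹ
  image-inverse {A = A} {B} p = S.≋-trans (S.≋-sym (·-homo A B)) (S.≋-trans (image-cong p) image-1ᴹ)

-- Finite sums over isomorphic setoids.

∑-reindex : ∀ {a ℓ₁ b ℓ₂ c ℓ₃} {S : Setoid a ℓ₁} {T : Setoid b ℓ₂} (R : CommutativeRing c ℓ₃)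
  (S-finite : Finite S) (T-finite : Finite T) (I : Inverse S T)
  (f : Func S (CommutativeRing.setoid R)) (g : Func T (CommutativeRing.setoid R)) →
  (∀ x → CommutativeRing._≈_ R (Func.to f x) (Func.to g (Inverse.to I x))) →
  CommutativeRing._≈_ R (∑ R S-finite f) (∑ R T-finite g)
∑-reindex {S = S} {T} R (_ , enumS) (_ , enumT) I f g f≈g = sym (trans
  (sum-permute (g.to ∘ T.to) π)
  (sum-cong-≋ λ i → trans (g.cong (T.strictlyInverseˡ (I.to (S.to i)))) (sym (f≈g (S.to i)))))
  where
  open Matrices R
  module S = Inverse (Bijection⇒Inverse enumS)
  module T = Inverse (Bijection⇒Inverse enumT)
  module I = Inverse I
  module g = Func g
  -- Each sum runs along its own enumeration, about which nothing is known. Conjugating `I` by the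
  -- two enumerations gives a permutation between the index sets, whose sizes are not assumed equal.
  π = Composition.inverse (Composition.inverse (Bijection⇒Inverse enumS) I) (Symmetry.inverse (Bijection⇒Inverse enumT))

open ℚᴹ using () renaming (Mat to Matℚ; Unipotent to Unipotentℚ)
open ℤᴹ using () renaming (Mat to Matℤ; Unipotent to Unipotentℤ)

module ℤᴵ = MatrixInverses ℤ-ring
module ℚᴵ = MatrixInverses ℚ-ring
module fromℤᴵ = HomomorphicImages ℤ-ring ℚ-ring fromℤ fromℤ-isRingHomomorphism
module fromℤ-hom = RingMorphisms.IsRingHomomorphism fromℤ-isRingHomomorphism

-- The torus element of the reversed tuple.

insertAt-inject₁ : ∀ {a} {A : Set a} {n} (t : Vector A n) x j → insertAt t (fromℕ n) x (inject₁ j) ≡ t j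
insertAt-inject₁ {n = suc n} t x zero    = ≡.refl
insertAt-inject₁ {n = suc n} t x (suc j) = insertAt-inject₁ (t ∘ suc) x j

-- `E` is a variable with a pointwise equation rather than `reverse D` itself. The construction can
-- then also be run from `reverse D` back to `D`, where the equation holds only through
-- `opposite-involutive`.
module ReversedTorus {r : ℕ} (D E : Vector ℕ r) (D>0 : ∀ i → NonZero (D i)) (E>0 : ∀ i → NonZero (E i))
  (E≡reverse-D : ∀ i → E i ≡ reverse D i) where

  private
    module D = Torus D D>0
    module E = Torus E E>0

  -- The cases are the first, the last and the inner entries. The conventional value 1 stands at
  -- both ends of `D̂`, so the padding is symmetric under reversal.
  D̂-reverse : ∀ i → E.D̂ i ≡ D.D̂ (opposite i)
  D̂-reverse zero = ≡.sym (insertAt-lookup D (fromℕ r) 1)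
  D̂-reverse (suc i) with view i
  ... | ‵fromℕ = ≡.trans (insertAt-lookup E (fromℕ r) 1)
    (≡.cong (D.D̂ ∘ inject₁) (≡.sym (opposite-swap {i = fromℕ r} {zero} ≡.refl)))
  ... | ‵inject₁ j = begin
    insertAt E (fromℕ r) 1 (inject₁ j)             ≡⟨ insertAt-inject₁ E 1 j ⟩
    E j                                            ≡⟨ E≡reverse-D j ⟩
    D (opposite j)                                 ≡⟨ insertAt-inject₁ D 1 (opposite j) ⟨
    D.D̂ (inject₁ (suc (opposite j)))               ≡⟨ ≡.cong (D.D̂ ∘ inject₁) (opposite-inject₁ j) ⟨
    D.D̂ (inject₁ (opposite (inject₁ j)))           ∎
    where open ≡.≡-Reasoning

  -- The entries of `c` are quotients of neighbours in `D̂`. Reversing `D̂` inverts each quotient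
  -- and reverses their order, that is, c̃ = w₀c⁻¹w₀⁻¹.
  c-reverse : ∀ l → E.c l ≡ D.c⁻¹ (opposite l)
  c-reverse l = ℚ./-cong {{E.D̂>0 (opposite (suc l))}} {{D.D̂>0 (opposite (inject₁ (opposite l)))}}
    (≡.cong +_ (≡.trans (D̂-reverse (opposite (inject₁ l))) (≡.cong (D.D̂ ∘ opposite) (opposite-inject₁ l))))
    (D̂-reverse (opposite (suc l)))

  private
    s : Fin (suc r) → ℚ
    s l = fromℤ (ℤᴹ.sign l)

    -- The scalar w₀².
    ε : ℚ
    ε = (ℚ.- 1ℚ) ℚᴹ.^ r

    ss : ∀ l → s l ℚ.* s l ≡ 1ℚ
    ss l = ≡.trans (≡.sym (fromℤ-hom.*-homo (ℤᴹ.sign l) (ℤᴹ.sign l))) (≡.cong fromℤ (ℤᴵ.sign² l))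

    ss-opposite : ∀ l → s l ℚ.* s (opposite l) ≡ ε
    ss-opposite l = ≡.trans (≡.cong₂ ℚ._*_ (fromℤᴵ.sign-homo l) (fromℤᴵ.sign-homo (opposite l))) (ℚᴵ.sign-opposite l)

    pivot-product : ∀ l → D.pivot (opposite l) ℚ.* E.pivot l ≡ ε
    pivot-product l = begin
      D.pivot l′ ℚ.* (E.c l′ ℚ.* s l)                       ≡⟨ ≡.cong (λ x → D.pivot l′ ℚ.* (x ℚ.* s l)) (c-reverse l′) ⟩
      -- The square of `s l′` is inserted: one factor completes `D.pivot⁻¹ l′`, the other pairs with
      -- `s l` to give `ε`.
      D.pivot l′ ℚ.* (c⁻¹ ℚ.* s l)                          ≡⟨ ≡.cong (λ x → D.pivot l′ ℚ.* (x ℚ.* s l)) (≡.trans (≡.cong (c⁻¹ ℚ.*_) (ss l′)) (ℚ.*-identityʳ c⁻¹)) ⟨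
      D.pivot l′ ℚ.* (c⁻¹ ℚ.* (s l′ ℚ.* s l′) ℚ.* s l)      ≡⟨ solve 4 (λ p c t u → p :* (c :* (t :* t) :* u) := p :* (c :* t) :* (u :* t)) ≡.refl (D.pivot l′) c⁻¹ (s l′) (s l) ⟩
      D.pivot l′ ℚ.* D.pivot⁻¹ l′ ℚ.* (s l ℚ.* s l′)        ≡⟨ ≡.cong₂ ℚ._*_ (D.pivot-inverse l′) (ss-opposite l) ⟩
      1ℚ ℚ.* ε                                              ≡⟨ ℚ.*-identityˡ ε ⟩
      ε                                                     ∎
      where
      open ≡.≡-Reasoning
      open import Algebra.Solver.Ring.NaturalCoefficients.Default ℚᴹ.commutativeSemiring
      l′ = opposite l
      c⁻¹ = D.c⁻¹ (opposite l′)

  open ℚᴹ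
  open ℚᴵ

  -- With c̃ = w₀c⁻¹w₀⁻¹ the product cw₀c̃w₀ collapses to cw₀²c⁻¹ = w₀².
  cw₀-product : D.cw₀ · E.cw₀ ≋ diagonal (λ _ → ε)
  cw₀-product .at i j = ≡.trans
    (sum-single {t = λ k → D.cw₀ i k ℚ.* E.cw₀ k j} (opposite j) λ k k≢ → *-zero {x = D.cw₀ i k} (E.cw₀-off {k} {j} k≢))
    (≡.trans (≡.cong (D.cw₀ i (opposite j) ℚ.*_) (E.cw₀-on j)) (go (i Fin.≟ j)))
    where
    go : Dec (i ≡ j) → D.cw₀ i (opposite j) ℚ.* E.pivot j ≡ diagonal (λ _ → ε) i j
    go (yes ≡.refl) = ≡.trans
      (≡.cong (ℚ._* E.pivot i) (≡.trans (≡.cong (λ k → D.cw₀ k (opposite i)) (≡.sym (Fin.opposite-involutive i))) (D.cw₀-on (opposite i))))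
      (≡.trans (pivot-product i) (≡.sym (diagonal-≡ (λ _ → ε) i)))
    go (no i≢j) = ≡.trans (zero-* {y = E.pivot j} (D.cw₀-off {i} {opposite j} λ p → i≢j (≡.trans p (Fin.opposite-involutive j))))
      (≡.sym (diagonal-≢ (λ _ → ε) i≢j))

  -- As w₀ᵀ = w₀⁻¹, the left side is w₀w₀⁻¹cw₀⁻¹ = cw₀⁻¹, and w₀⁻¹ = εw₀.
  cw₀-♯ : ∀ i j → (D.cw₀ ♯) i j ≡ ε ℚ.* D.cw₀ i j
  cw₀-♯ i j = go (i Fin.≟ opposite j)
    where
    go : Dec (i ≡ opposite j) → (D.cw₀ ♯) i j ≡ ε ℚ.* D.cw₀ i j
    go (yes ≡.refl) = ≡.cong₂ ℚ._*_ (≡.trans (ℚ.*-comm (sign (opposite j)) (sign j)) (sign-opposite j))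
      (≡.cong (D.cw₀ (opposite j)) (Fin.opposite-involutive j))
    go (no p) = ≡.trans (*-zero {x = sign i ℚ.* sign j} (D.cw₀-off {opposite j} {opposite i} λ q → p (≡.sym (≡.trans q (Fin.opposite-involutive i)))))
      (≡.sym (*-zero {x = ε} (D.cw₀-off {i} {j} p)))

  -- (c_E w₀)⁻¹ = w₀⁻¹ c_E⁻¹ and ♯ is conjugation of the transpose by w₀.
  cw₀-inverse : E.cw₀ ♯ · D.cw₀ ≋ 1ᴹ
  cw₀-inverse = ≋-trans (·-cong (≋-refl {A = E.cw₀ ♯}) (≋-sym (♯-involutive D.cw₀)))
    (♯-inverse {A = D.cw₀ ♯} {E.cw₀} (entrywise λ i j → begin
      sum (λ k → (D.cw₀ ♯) i k ℚ.* E.cw₀ k j)        ≡⟨ sum-cong-≋ (λ k → ≡.trans (≡.cong (ℚ._* E.cw₀ k j) (cw₀-♯ i k)) (ℚ.*-assoc ε (D.cw₀ i k) (E.cw₀ k j))) ⟩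
      sum (λ k → ε ℚ.* (D.cw₀ i k ℚ.* E.cw₀ k j))    ≡⟨ *-distribˡ-sum ε (λ k → D.cw₀ i k ℚ.* E.cw₀ k j) ⟨
      ε ℚ.* (D.cw₀ · E.cw₀) i j                      ≡⟨ ≡.cong (ε ℚ.*_) (cw₀-product .at i j) ⟩
      ε ℚ.* diagonal (λ _ → ε) i j                   ≡⟨ go i j (i Fin.≟ j) ⟩
      1ᴹ i j                                         ∎))
    where
    open ≡.≡-Reasoning
    go : ∀ i j → Dec (i ≡ j) → ε ℚ.* diagonal (λ _ → ε) i j ≡ 1ᴹ i j
    go i j (yes ≡.refl) = begin
      ε ℚ.* diagonal (λ _ → ε) i i                            ≡⟨ ≡.cong (ε ℚ.*_) (diagonal-≡ (λ _ → ε) i) ⟩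
      ε ℚ.* ε                                                 ≡⟨ ≡.cong₂ ℚ._*_ (ss-opposite i) (ss-opposite i) ⟨
      s i ℚ.* s i′ ℚ.* (s i ℚ.* s i′)                         ≡⟨ solve 2 (λ a b → a :* b :* (a :* b) := a :* a :* (b :* b)) ≡.refl (s i) (s i′) ⟩
      s i ℚ.* s i ℚ.* (s i′ ℚ.* s i′)                         ≡⟨ ≡.cong₂ ℚ._*_ (ss i) (ss i′) ⟩
      1ℚ                                                      ≡⟨ diagonal-≡ (λ _ → 1ℚ) i ⟨
      1ᴹ i i                                                  ∎
      where
      open import Algebra.Solver.Ring.NaturalCoefficients.Default ℚᴹ.commutativeSemiring
      i′ = opposite i
    go i j (no i≢j) = ≡.trans (*-zero {x = ε} (diagonal-≢ (λ _ → ε) i≢j)) (≡.sym (diagonal-≢ (λ _ → 1ℚ) i≢j))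

  -- By `cw₀-product` the two determinants multiply to `ε ^ suc r`, which is -1 to the even power
  -- r(r + 1).
  cw₀-det : det D.cw₀ ≡ 1ℚ → det E.cw₀ ≡ 1ℚ
  cw₀-det p = begin
    det E.cw₀                     ≡⟨ ℚ.*-identityˡ _ ⟨
    1ℚ ℚ.* det E.cw₀              ≡⟨ ≡.cong (ℚ._* det E.cw₀) p ⟨
    det D.cw₀ ℚ.* det E.cw₀       ≡⟨ det-· D.cw₀ E.cw₀ ⟨
    det (D.cw₀ · E.cw₀)           ≡⟨ det-cong {A = D.cw₀ · E.cw₀} {diagonal (λ _ → ε)} cw₀-product ⟩
    det (diagonal {suc r} (λ _ → ε)) ≡⟨ det-scalar (suc r) ε ⟩
    ε ^ suc r                     ≡⟨ [-1]^n[n+1] r ⟩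
    1ℚ                            ∎
    where
    open Determinants ℚ-ring
    open ≡.≡-Reasoning

-- The automorphism θ on integral matrices.

det-bruhat : ∀ {n} (B : Matℤ n n) {P Q : Matℚ n n} (W : Matℚ n n) → Unipotentℚ P → Unipotentℚ Q →
  fromℤᴹ.image B ℚᴹ.≋ P ℚᴹ.· W ℚᴹ.· Q → fromℤ (ℤᴹ.det B) ≡ ℚᴹ.det W
det-bruhat B {P} {Q} W p q eq = begin
  fromℤ (ℤᴹ.det B)                 ≡⟨ fromℤᴵ.det-homo B ⟩
  det (fromℤᴹ.image B)             ≡⟨ det-cong {A = fromℤᴹ.image B} {P · W · Q} eq ⟩
  det (P · W · Q)                  ≡⟨ ≡.trans (det-· (P · W) Q) (≡.cong (ℚ._* det Q) (det-· P W)) ⟩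
  det P ℚ.* det W ℚ.* det Q        ≡⟨ ≡.cong₂ (λ s t → s ℚ.* det W ℚ.* t) (det-unipotent p) (det-unipotent q) ⟩
  1ℚ ℚ.* det W ℚ.* 1ℚ              ≡⟨ ≡.trans (ℚ.*-identityʳ _) (ℚ.*-identityˡ (det W)) ⟩
  det W                            ∎
  where
  open ℚᴹ using (det; _·_)
  open Determinants ℚ-ring
  open ≡.≡-Reasoning

-- This is θ. For determinant 1 the adjugate is the inverse, and it is integral by construction.
dual : ∀ {r} → Matℤ (suc r) (suc r) → Matℤ (suc r) (suc r)
dual γ = ℤᴵ.adjugate γ ℤᴵ.♯

module _ {r : ℕ} where
  open ℤᴹ
  open ℤᴵ

  -- Applying ♯ to `adjugate γ · γ ≋ 1ᴹ` shows that `γ ♯` is inverse to `dual γ`, hence equal to its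
  -- adjugate; a second ♯ returns `γ`.
  dual-involutive : {γ : Matℤ (suc r) (suc r)} → det γ ≡ 1ℤ → det (dual γ) ≡ 1ℤ → dual (dual γ) ≋ γ
  dual-involutive {γ} p q = ≋-trans
    (♯-cong {A = adjugate (dual γ)} {γ ♯} (≋-sym (inverse-unique {X = γ ♯} {dual γ} {adjugate (dual γ)}
      (♯-inverse {A = adjugate γ} {γ} (adjugate-· {A = γ} p)) (·-adjugate {A = dual γ} q))))
    (♯-involutive γ)

  -- Inversion and ♯ each reverse products, so `dual` keeps their order and carries double cosets of
  -- U(ℤ) to double cosets.
  dual-·₃ : {γ δ u v : Matℤ (suc r) (suc r)} → det γ ≡ 1ℤ → det δ ≡ 1ℤ → Unipotentℤ u → Unipotentℤ v →
    δ ≋ u · γ · v → dual δ ≋ inv u ♯ · dual γ · inv v ♯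
  dual-·₃ {γ} {δ} {u} {v} p q u-unip v-unip e = ≋-trans
    (♯-cong {A = adjugate δ} {inv v · adjugate γ · inv u} (≋-sym (inverse-unique {X = inv v · adjugate γ · inv u} {δ} {adjugate δ}
      (≋-trans (·-cong (≋-refl {A = inv v · adjugate γ · inv u}) e)
        (·₃-inverse {A = u} {γ} {v} {inv u} {adjugate γ} {inv v} (·-inverseˡ u-unip) (adjugate-· {A = γ} p) (·-inverseˡ v-unip)))
      (·-adjugate {A = δ} q))))
    (♯-·₃ (inv v) (adjugate γ) (inv u))

-- Characters and Bruhat cells under θ.

module _ {a ℓ₁ b ℓ₂} (𝓔 : Exponential a ℓ₁ b ℓ₂) where

  open Exponential 𝓔
  open Kloosterman 𝓔
  open Cell
  private module e = MonoidMorphisms.IsMonoidHomomorphism e-isMonoidHomomorphism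

  ψ-reverse : ∀ {r} (T : Vector ℤ r) (b b′ : ℝᴹ.Mat (suc r) (suc r)) →
    (∀ i → b′ (inject₁ i) (suc i) ℝ.≈ b (inject₁ (opposite i)) (suc (opposite i))) → ψ T b ℂ.≈ ψ (reverse T) b′
  ψ-reverse T b b′ p = e.⟦⟧-cong (ℝ.trans
    (ℝᴹ.sum-permute (λ i → ιℤ (T i) ℝ.* b (inject₁ i) (suc i)) Permutation.reverse)
    (ℝᴹ.sum-cong-≋ λ i → ℝ.*-congˡ (ℝ.sym (p i))))

  -- The relation `~` sees only the matrix `γ` of a cell, not the factors carried with it.
  ≋⇒~ : ∀ {r} {D : Vector ℕ r} {D>0 : ∀ i → NonZero (D i)} {x y : Cell D D>0} → γ y ℤᴹ.≋ γ x → _~_ D D>0 x y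
  ≋⇒~ {x = x} p = 1ᴹ , 1ᴹ , 1ᴹ-unipotent , 1ᴹ-unipotent ,
    ≋-trans p (≋-sym (≋-trans (·-identityʳ (1ᴹ · γ x)) (·-identityˡ (γ x))))
    where open ℤᴹ

  module DualCell {r : ℕ} (D E : Vector ℕ r) (D>0 : ∀ i → NonZero (D i)) (E>0 : ∀ i → NonZero (E i))
    (E≡reverse-D : ∀ i → E i ≡ reverse D i) where

    private
      module D = Torus D D>0
      module E = Torus E E>0
    open ReversedTorus D E D>0 E>0 E≡reverse-D

    module _ (x : Cell D D>0) where
      open ℚᴹ
      open ℚᴵ

      -- Taking the rational factors of `γ x` in place of `b₁ x` and `b₂ x` keeps the duality
      -- computation over ℚ, which is the input that `fromRational` expects.
      L R : Matℚ (suc r) (suc r)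
      L = D.left (γ x)
      R = D.right (γ x)

      L-unipotent : Unipotentℚ L
      L-unipotent = proj₁ (cell⇒inCell D D>0 x)

      R-unipotent : Unipotentℚ R
      R-unipotent = proj₁ (proj₂ (cell⇒inCell D D>0 x))

      γ-bruhat : fromℤᴹ.image (γ x) ≋ L · D.cw₀ · R
      γ-bruhat = proj₂ (proj₂ (cell⇒inCell D D>0 x))

      L′ R′ : Matℚ (suc r) (suc r)
      L′ = inv L ♯
      R′ = inv R ♯

      L′-unipotent : Unipotentℚ L′
      L′-unipotent = ♯-unipotent (inv-unipotent L)

      R′-unipotent : Unipotentℚ R′
      R′-unipotent = ♯-unipotent (inv-unipotent R)

      -- Inverting the factorisation of `γ x` gives `inv R · E.cw₀ ♯ · inv L`, which must be the
      -- image of the adjugate because both are inverse to the image of `γ x`. Then ♯ restores the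
      -- order of the factors and cancels the ♯ on `E.cw₀`.
      dual-bruhat : fromℤᴹ.image (dual (γ x)) ≋ L′ · E.cw₀ · R′
      dual-bruhat = ≋-trans (fromℤᴵ.♯-homo A)
        (≋-trans (♯-cong {A = fromℤᴹ.image A} {inv R · E.cw₀ ♯ · inv L} (≋-sym A-bruhat))
        (≋-trans (♯-·₃ (inv R) (E.cw₀ ♯) (inv L))
        (·-cong (·-cong (≋-refl {A = L′}) (♯-involutive E.cw₀)) (≋-refl {A = R′}))))
        where
        A : Matℤ (suc r) (suc r)
        A = ℤᴵ.adjugate (γ x)
        A-bruhat : inv R · E.cw₀ ♯ · inv L ≋ fromℤᴹ.image A
        A-bruhat = inverse-unique {X = inv R · E.cw₀ ♯ · inv L} {fromℤᴹ.image (γ x)} {fromℤᴹ.image A}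
          (≋-trans (·-cong (≋-refl {A = inv R · E.cw₀ ♯ · inv L}) γ-bruhat)
            (·₃-inverse {A = L} {D.cw₀} {R} {inv L} {E.cw₀ ♯} {inv R} (·-inverseˡ L-unipotent) cw₀-inverse (·-inverseˡ R-unipotent)))
          (fromℤᴵ.image-inverse {A = γ x} {A} (ℤᴵ.·-adjugate {A = γ x} (det-γ x)))

      det-dual : ℤᴹ.det (dual (γ x)) ≡ 1ℤ
      -- `det-bruhat` is used in both directions: determinant 1 passes from `γ x` to `D.cw₀`, then
      -- by `cw₀-det` to `E.cw₀`, and from there to the dual matrix.
      det-dual = fromℤ-injective (≡.trans (det-bruhat (dual (γ x)) E.cw₀ L′-unipotent R′-unipotent dual-bruhat)
        (cw₀-det (≡.trans (≡.sym (det-bruhat (γ x) D.cw₀ L-unipotent R-unipotent γ-bruhat)) (≡.cong fromℤ (det-γ x)))))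

      dualCell : Cell E E>0
      dualCell = fromRational E E>0 (dual (γ x)) L′ R′ det-dual L′-unipotent R′-unipotent dual-bruhat

      -- Both unipotent factors have their superdiagonals reversed, which matches the reversed
      -- tuples. Since `weight` itself reverses its first tuple, `ψ-reverse` is applied there to
      -- `reverse M`.
      weight-dual : ∀ M N → weight D D>0 M N x ℂ.≈ weight E E>0 (reverse M) (reverse N) dualCell
      weight-dual M N = ℂ.*-cong
        (ψ-reverse (reverse M) (b₁ x) (ιᴹ.image L′) λ i → ℝ.trans
          (ι-mono.⟦⟧-cong (inv♯-superdiagonal L-unipotent i)) (ℝ.sym (b₁-rational D D>0 x .ℝᴹ.at _ _)))
        (ψ-reverse N (b₂ x) (ιᴹ.image R′) λ i → ℝ.trans
          (ι-mono.⟦⟧-cong (inv♯-superdiagonal R-unipotent i)) (ℝ.sym (b₂-rational D D>0 x .ℝᴹ.at _ _)))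

    dualCell-cong : ∀ {x y} → _~_ D D>0 x y → _~_ E E>0 (dualCell x) (dualCell y)
    dualCell-cong {x} {y} (u , v , u-unip , v-unip , p) =
      ℤᴹ.inv u ℤᴵ.♯ , ℤᴹ.inv v ℤᴵ.♯ , ℤᴵ.♯-unipotent (ℤᴹ.inv-unipotent u) , ℤᴵ.♯-unipotent (ℤᴹ.inv-unipotent v) ,
      dual-·₃ {γ = γ x} {γ y} (det-γ x) (det-γ y) u-unip v-unip p

  X-inverse : ∀ {r} (D E : Vector ℕ r) (D>0 : ∀ i → NonZero (D i)) (E>0 : ∀ i → NonZero (E i)) →
    (∀ i → E i ≡ reverse D i) → (∀ i → D i ≡ reverse E i) → Inverse (X D D>0) (X E E>0)
  X-inverse D E D>0 E>0 p q = record
    { to        = D→E.dualCell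
    ; from      = E→D.dualCell
    ; to-cong   = λ {x} {y} → D→E.dualCell-cong {x} {y}
    ; from-cong = λ {x} {y} → E→D.dualCell-cong {x} {y}
    ; inverse   =
      -- Congruence reduces the claim to comparing `x` with its double dual, whose matrix is
      -- `dual (dual (γ x))`.
      (λ {x} {y} y~ → ~-trans E E>0 {D→E.dualCell y} {D→E.dualCell (E→D.dualCell x)} {x} (D→E.dualCell-cong {y} {E→D.dualCell x} y~)
        (≋⇒~ {x = D→E.dualCell (E→D.dualCell x)} {x} (ℤᴹ.≋-sym (dual-involutive {γ = γ x} (det-γ x) (E→D.det-dual x))))) ,
      (λ {x} {y} y~ → ~-trans D D>0 {E→D.dualCell y} {E→D.dualCell (D→E.dualCell x)} {x} (E→D.dualCell-cong {y} {D→E.dualCell x} y~)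
        (≋⇒~ {x = E→D.dualCell (D→E.dualCell x)} {x} (ℤᴹ.≋-sym (dual-involutive {γ = γ x} (det-γ x) (D→E.det-dual x)))))
    }
    where
    module D→E = DualCell D E D>0 E>0 p
    module E→D = DualCell E D E>0 D>0 q

proposition3p6 : ∀ {a ℓ₁ b ℓ₂} (𝓔 : Exponential a ℓ₁ b ℓ₂) (r : ℕ) → 2 ≤ suc r →
    (M N : Vector ℤ r) (D : Vector ℕ r) (D>0 : ∀ i → NonZero (D i)) →
    let open Kloosterman 𝓔 in
    S M N D D>0 ≈ℂ S (reverse M) (reverse N) (reverse D) (λ i → D>0 (opposite i))
proposition3p6 𝓔 r _ M N D D>0 = ∑-reindex (Exponential.ℂ 𝓔)
  (X-finite D D>0) (X-finite (reverse D) (D>0 ∘ opposite))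
  -- The first equation holds by definition; the second, for reversing back, is only pointwise and
  -- uses that `opposite` is an involution.
  (X-inverse 𝓔 D (reverse D) D>0 (D>0 ∘ opposite) (λ _ → ≡.refl) (λ i → ≡.cong D (≡.sym (Fin.opposite-involutive i))))
  (phase D D>0 M N) (phase (reverse D) (D>0 ∘ opposite) (reverse M) (reverse N))
  (λ x → DualCell.weight-dual 𝓔 D (reverse D) D>0 (D>0 ∘ opposite) (λ _ → ≡.refl) x M N)
  where open Kloosterman 𝓔
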